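{- Let $n\ge 1$ and let $\mathbf{m}=(m_1,\dots,m_n)$, $\mathbf{r}=(r_1,\dots,r_n)$ be vectors of positive integers, $m=m_1+\cdots+m_n$, $r=\max\{r_1,\dots,r_n\}$. Then, as formal power series in the variables $z_{k^l}$ ($1\le k\le n$, $1\le l\le r_k$), $y_1,\dots,y_r$ and $z_{m+1}$, $$\sum_{\pi^{\mathbf{c}}\in\mathfrak{S}_{\mathbf{m}}^{\mathbf{r}}}\frac{\prod_{p=1}^{r}y_p^{c_p(\pi^{\mathbf{c}})}\prod_{\substack{i\in\{2,\dots,m+1\}\\ i-1\in\mathrm{DES}(\pi^{\mathbf{c}})}}z_{\pi_i^{c_i}}^{r_{\pi_i}}\cdots z_{\pi_m^{c_m}}^{r_{\pi_m}}z_{m+1}}{\prod_{i=1}^{m+1}\bigl(1-z_{\pi_i^{c_i}}^{r_{\pi_i}}\cdots z_{\pi_m^{c_m}}^{r_{\pi_m}}z_{m+1}\bigr)}=\sum_{t\ge0}z_{m+1}^t\prod_{k=1}^n\left(\sum_{(i_{1;k},\dots,i_{r_k;k})}\ \prod_{l=1}^{r_k}\begin{bmatrix}t+\lfloor\frac{1-l}{l}\rfloor+i_{l;k}\\ i_{l;k}\end{bmatrix}_{z_{k^l}^{r_k}}y_l^{i_{l;k}}\right),$$ where, for each $k$, the inner sum is over all tuples of nonnegative integers $(i_{1;k},\dots,i_{r_k;k})$ with $i_{1;k}+\cdots+i_{r_k;k}=m_k$. For $i=m+1$ the expression $z_{\pi_i^{c_i}}^{r_{\pi_i}}\cdots z_{\pi_m^{c_m}}^{r_{\pi_m}}z_{m+1}$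 is just $z_{m+1}$.
   Context: $\mathfrak{S}_{\mathbf{m}}^{\mathbf{r}}$ denotes the set of colored multiset permutations: words $\pi^{\mathbf{c}}=\pi_1^{c_1}\pi_2^{c_2}\cdots\pi_m^{c_m}$ in which each $k\in\{1,\dots,n\}$ appears exactly $m_k$ times among $\pi_1,\dots,\pi_m$, and each color $c_j$ is an integer with $1\le c_j\le r_{\pi_j}$. One always appends $\pi_{m+1}^{c_{m+1}}:=(n+1)^1$. Colored letters are totally ordered by the color ordering: $k^{c}<l^{c'}$ iff $c<c'$, or $c=c'$ and $k<l$. An index $j\in\{1,\dots,m\}$ is a descent of $\pi^{\mathbf{c}}$ if $\pi_j^{c_j}>\pi_{j+1}^{c_{j+1}}$; $\mathrm{DES}(\pi^{\mathbf{c}})$ is the set of descents. For $p\in\{1,\dots,r\}$, $c_p(\pi^{\mathbf{c}})$ is the number of $j\in\{1,\dots,m\}$ with $c_j=p$ (the appended letter is not counted). $\begin{bmatrix}N\\ M\end{bmatrix}_q$ is the Gaussian ($q$-)binomial coefficient $\prod_{i=1}^{M}\frac{1-q^{N-M+i}}{1-q^i}$, equal to $1$ when $M=0$ and to $0$ when $N=M-1$, $M\ge1$. $\lfloor\cdot\rfloor$ is the floor function. -}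

module Defs where

open import Algebra.Bundles.Raw using (RawRing)
import Algebra.Definitions.RawSemiring as RawSemiringDefinitions
open import Data.Bool.Base using (if_then_else_)
open import Data.Fin.Base using (Fin; zero; suc; toℕ; inject₁; inject≤; _↑ˡ_; _↑ʳ_)
import Data.Fin.Properties as Fin
open import Data.Integer.Base as ℤ using (ℤ; +_; 0ℤ; 1ℤ; ∣_∣)
open import Data.List.Base as List using (List; []; _∷_; upTo; allFin; cartesianProductWith; concatMap; filter; drop)
open import Data.Nat.Base as ℕ using (ℕ; zero; suc; _≤_; _<_; _⊔_)
import Data.Nat.Properties as ℕ
open import Data.Product.Base using (_×_; _,_; ∃)
open import Data.Sum.Base using (_⊎_)
open import Data.Vec.Base as Vec using (Vec; []; _∷_; _∷ʳ_; replicate; zipWith; lookup; toList; count; _[_]≔_)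
import Data.Vec.Properties as Vec
open import Data.Vec.Functional using (Vector; foldr)
open import Level using (0ℓ)
open import Relation.Binary.PropositionalEquality using (_≡_)
open import Relation.Nullary.Decidable using (Dec; does; _×-dec_; _⊎-dec_)
open import Relation.Unary using (Decidable)

-- Vectors componentwise below a given one.
below : ∀ {N} → Vec ℕ N → List (Vec ℕ N)
below []      = [] ∷ []
below (a ∷ α) = cartesianProductWith _∷_ (upTo (suc a)) (below α)

-- Formal power series over ℤ in N variables: α ↦ coefficient of X^α.
module PowerSeries (N : ℕ) where

  Series : Set
  Series = Vec ℕ N → ℤ

  infix  4 _≈_ _SumsTo_
  infixr 5 ∑ ∏
  infixl 6 _-_
  infixl 7 _*_
  infix  8 _⁻¹

  _≈_ : Series → Series → Set
  f ≈ g = ∀ α → f α ≡ g α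

  monomial : Vec ℕ N → Series
  monomial β α = if does (Vec.≡-dec ℕ._≟_ β α) then 1ℤ else 0ℤ

  X : Fin N → Series
  X i = monomial (replicate N 0 [ i ]≔ 1)

  _*_ : Series → Series → Series
  (f * g) α = List.foldr ℤ._+_ 0ℤ
    (List.map (λ β → f β ℤ.* g (zipWith ℕ._∸_ α β)) (below α))

  rawRing : RawRing 0ℓ 0ℓ
  rawRing = record
    { Carrier = Series
    ; _≈_     = _≈_
    ; _+_     = λ f g α → f α ℤ.+ g α
    ; _*_     = _*_
    ; -_      = λ f α → ℤ.- f α
    ; 0#      = λ _ → 0ℤ
    ; 1#      = monomial (replicate N 0)
    }

  open RawRing rawRing public using (_+_; -_; 0#; 1#)
  open RawSemiringDefinitions (RawRing.rawSemiring rawRing) public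
    using (_^_; product)

  _-_ : Series → Series → Series
  f - g = f + (- g)

  ∑ : {A : Set} → List A → (A → Series) → Series
  ∑ xs f = List.foldr _+_ 0# (List.map f xs)

  syntax ∑ xs (λ x → e) = ∑[ x ∈ xs ] e

  ∏ : (n : ℕ) → (Fin n → Series) → Series
  ∏ n f = product f

  syntax ∏ n (λ i → e) = ∏[ i < n ] e

  -- The inverse of a series f with constant coefficient 1, as the geometric
  -- series in 1 - f: powers beyond the degree of α do not contribute at α.
  _⁻¹ : Series → Series
  (f ⁻¹) α = (∑[ j ∈ upTo (suc (Vec.sum α)) ] (1# - f) ^ j) α

  -- Each coefficient of the partial sums ∑_{t<T} f t is eventually that of s.
  _SumsTo_ : (ℕ → Series) → Series → Set
  f SumsTo s = ∀ α → ∃ λ T₀ → ∀ T → T₀ ≤ T → (∑[ t ∈ upTo T ] f t) α ≡ s α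

  -- The q-binomial coefficient for q without constant term and N ≥ M - 1;
  -- the exponents N - M + i (1 ≤ i ≤ M) are then non-negative.
  gaussian : ℤ → ℕ → Series → Series
  gaussian N M q =
    ∏[ i < M ] (1# - q ^ ∣ N ℤ.- + M ℤ.+ + suc (toℕ i) ∣) * (1# - q ^ suc (toℕ i)) ⁻¹

total : ∀ {n} → Vector ℕ n → ℕ
total = foldr ℕ._+_ 0

maximum : ∀ {n} → Vector ℕ n → ℕ
maximum = foldr _⊔_ 0

≤-maximum : ∀ {n} (r : Vector ℕ n) k → r k ≤ maximum r
≤-maximum r zero    = ℕ.m≤m⊔n _ _
≤-maximum r (suc k) = ℕ.≤-trans (≤-maximum (λ i → r (suc i)) k) (ℕ.m≤n⊔m _ _)

-- Concatenates blocks of lengths r zero, r (suc zero), ….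
flatten : ∀ {n} (r : Vector ℕ n) k → Fin (r k) → Fin (total r)
flatten r zero    l = l ↑ˡ _
flatten r (suc k) l = r zero ↑ʳ flatten (λ i → r (suc i)) k l

-- Tuples (i₁, …, i_s) of natural numbers with i₁ + ⋯ + i_s = N.
tuplesWithSum : (s N : ℕ) → List (Vec ℕ s)
tuplesWithSum s N = filter (λ i → Vec.sum i ℕ.≟ N) (below (replicate s N))

-- Letters k : Fin n and colours c : Fin (r k) are numbered from 0 and stand
-- for the letter suc (toℕ k) and the colour suc (toℕ c).
module ColouredPermutations {n : ℕ} (m r : Vector ℕ n) where

  |m| r-max : ℕ
  |m|   = total m
  r-max = maximum r

  record Letter : Set where
    constructor _^ᶜ_
    field
      letter : Fin n
      colour : Fin (r letter)

  open Letter public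

  Word : Set
  Word = Vec Letter |m|

  HasContent : Word → Set
  HasContent π = ∀ k → count (λ a → letter a Fin.≟ k) π ≡ m k

  hasContent? : Decidable HasContent
  hasContent? π = Fin.all? λ k → count (λ a → letter a Fin.≟ k) π ℕ.≟ m k

  letters : List Letter
  letters = concatMap (λ k → List.map (k ^ᶜ_) (allFin (r k))) (allFin n)

  wordsOver : {A : Set} → List A → (s : ℕ) → List (Vec A s)
  wordsOver as zero    = [] ∷ []
  wordsOver as (suc s) = cartesianProductWith _∷_ as (wordsOver as s)

  𝔖 : List Word
  𝔖 = filter hasContent? (wordsOver letters |m|)

  -- The colour order on pairs (k , c) representing k^c.
  infix 4 _<ᶜ_ _<ᶜ?_

  _<ᶜ_ : ℕ × ℕ → ℕ × ℕ → Set
  (k , c) <ᶜ (l , c′) = c < c′ ⊎ (c ≡ c′ × k < l)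

  _<ᶜ?_ : ∀ a b → Dec (a <ᶜ b)
  (k , c) <ᶜ? (l , c′) = (c ℕ.<? c′) ⊎-dec ((c ℕ.≟ c′) ×-dec (k ℕ.<? l))

  numbered : Letter → ℕ × ℕ
  numbered (k ^ᶜ c) = suc (toℕ k) , suc (toℕ c)

  extended : Word → Vec (ℕ × ℕ) (suc |m|)
  extended π = Vec.map numbered π ∷ʳ (suc n , 1)

  -- j : Fin |m| stands for the position suc (toℕ j).
  Descent : Word → Fin |m| → Set
  Descent π j = lookup (extended π) (suc j) <ᶜ lookup (extended π) (inject₁ j)

  descent? : ∀ π → Decidable (Descent π)
  descent? π j = lookup (extended π) (suc j) <ᶜ? lookup (extended π) (inject₁ j)

  colourCount : Fin r-max → Word → ℕ
  colourCount p = count (λ a → toℕ (colour a) ℕ.≟ toℕ p)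

  open PowerSeries (total r ℕ.+ (r-max ℕ.+ 1)) public

  z : (k : Fin n) → Fin (r k) → Series
  z k l = X (flatten r k l ↑ˡ _)

  y : Fin r-max → Series
  y p = X (total r ↑ʳ (p ↑ˡ 1))

  -- The variable z_{m+1}.
  w : Series
  w = X (total r ↑ʳ (r-max ↑ʳ zero))

  -- The product of z_{π_j^{c_j}}^{r_{π_j}} over the positions j ≥ i, times w.
  tailProduct : Word → Fin (suc |m|) → Series
  tailProduct π i =
    List.foldr _*_ 1#
      (List.map (λ a → z (letter a) (colour a) ^ r (letter a)) (drop (toℕ i) (toList π)))
    * w

  numerator : Word → Series
  numerator π =
    (∏[ p < r-max ] y p ^ colourCount p π) *
    (∏[ j < |m| ] (if does (descent? π j) then tailProduct π (suc j) else 1#))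

  denominator : Word → Series
  denominator π = ∏[ i < suc |m| ] (1# - tailProduct π i)

-- Expanding the fraction attached to a word π as a power series in z_{m+1},
-- the coefficient of z_{m+1}^t sums ∏ z_{π_i}^{r f_i} over the sequences
-- 0 ≤ f_1 ≤ ⋯ ≤ f_m ≤ f_{m+1} = t that increase strictly at the descents of π.
-- These are the sequences for which the pairs (f_i , π_i) increase weakly in
-- the lexicographic order and stay below (t , (n+1)¹), so summing over all π
-- counts multisets of pairs (v , k^l) with v ≤ t if l = 1 and v < t if l ≥ 2,
-- which split as a product over k and l.  The factor of k^l is the complete
-- homogeneous polynomial h_i(y, y q, …, y q^t), respectively
-- h_i(y, …, y q^(t-1)), with q = z_{k^l}^{r_k}, a q-binomial coefficient times y^i.
-- The sums over t are truncated: everything is computed modulo z_{m+1}^T.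
module Submission where

open import Algebra.Bundles using (AbelianGroup; CommutativeRing; Semiring)
import Algebra.Definitions.RawSemiring as RawSemiringDefinitions
import Algebra.Morphism.RingMonomorphism as RingMonomorphism
open import Algebra.Morphism.Structures using (IsRingMonomorphism)
import Algebra.Properties.CommutativeMonoid.Sum as CommutativeMonoidSum
import Algebra.Properties.CommutativeSemigroup as CommutativeSemigroupProperties
import Algebra.Properties.CommutativeSemiring.Exp as CommutativeSemiringExp
import Algebra.Properties.Group as GroupProperties
import Algebra.Properties.Ring as RingProperties
open import Algebra.Structures using (IsCommutativeRing)
open import Data.Bool.Base using (Bool; false; if_then_else_; true)
open import Data.Fin.Base as Fin using (Fin; _↑ʳ_; _↑ˡ_; inject₁; inject≤; suc; toℕ; zero)
import Data.Fin.Properties as Fin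
open import Data.Integer.Base as ℤ using (+_; -1ℤ; 0ℤ; ℤ; ∣_∣)
import Data.Integer.Properties as ℤ
open import Data.List.Base using (List; []; _++_; _∷_; allFin; cartesianProductWith; drop; filter; foldr; map; upTo)
open import Data.List.Membership.Propositional using (_∈_)
open import Data.List.Membership.Propositional.Properties
  using (∈-allFin; ∈-cartesianProductWith⁻; ∈-concat⁺′; ∈-filter⁺; ∈-map⁺; ∈-map⁻; ∈-upTo⁻)
open import Data.List.Properties using (++-identityʳ; filter-++; filter-accept; filter-reject; map-++; map-upTo; upTo-∷ʳ)
open import Data.List.Relation.Binary.Permutation.Propositional using (↭-sym; ↭⇒↭ₛ)
open import Data.List.Relation.Binary.Permutation.Propositional.Properties using (∈-resp-↭)
import Data.List.Relation.Binary.Permutation.Setoid.Properties as PermutationSetoid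
open import Data.List.Relation.Unary.All as All using (All; []; _∷_)
import Data.List.Relation.Unary.All.Properties as All
open import Data.List.Relation.Unary.AllPairs as AllPairs using (AllPairs; []; _∷_)
import Data.List.Relation.Unary.AllPairs.Properties as AllPairs
open import Data.List.Relation.Unary.Any using (here; there)
open import Data.List.Relation.Unary.Sorted.TotalOrder.Properties using (Sorted⇒AllPairs)
open import Data.List.Relation.Unary.Unique.Propositional using (Unique)
import Data.List.Relation.Unary.Unique.Propositional.Properties as Unique
import Data.List.Sort as Sort
open import Data.Nat.Base as ℕ using (_<_; _∸_; _≡ᵇ_; _≤_; pred; suc; s≤s; zero; z≤n; ℕ)
import Data.Nat.DivMod as ℕ
import Data.Nat.Properties as ℕ
open import Data.Product.Base using (_,_; _×_; proj₁; proj₂; swap; ∃)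
open import Data.Product.Relation.Binary.Lex.Strict using (×-strictTotalOrder)
open import Data.Rational.Unnormalised.Base using (_/_; floor)
open import Data.Sum.Base using (inj₁; inj₂)
open import Data.Vec.Base as Vec using (Vec; []; _∷_; _∷ʳ_; count; lookup; replicate; toList)
open import Data.Vec.Functional using (Vector)
import Data.Vec.Properties as Vec
open import Defs
open import Function.Base using (_∘_; id)
open import Function.Bundles using (mk⇔)
open import Relation.Binary.Bundles using (DecTotalOrder; StrictTotalOrder)
import Relation.Binary.Construct.On as On
open import Relation.Binary.Definitions using (DecidableEquality)
import Relation.Binary.Properties.StrictTotalOrder as StrictTotalOrderProperties
open import Relation.Binary.PropositionalEquality as ≡ using (_≡_; _≢_)
import Relation.Binary.Reasoning.Setoid as SetoidReasoning
open import Relation.Nullary using (Dec; contradiction; no; yes; ¬_)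
open import Relation.Nullary.Decidable using (dec-false; dec-true; does; does-⇔; map′)
open import Relation.Unary using (Decidable)

-- No bijection with multisets is written down: both passages, from a fraction to its coefficients
-- and from words to products, compare recurrences. Every factor of the denominator depends only on
-- a suffix of π, so deleting the first letter removes one such factor and at most one factor of the
-- numerator.
--
-- The floor comes from the appended letter: (n+1)¹ lies above all letters of colour 1 and below all
-- letters of later colours, so level t is open to colour 1 only. A colour l thus has c = t + 1 +
-- floor((1-l)/l) levels, and h_i of c terms in geometric progression is y^i times the q-binomial
-- with upper entry c - 1 + i.
--
-- The argument runs in an arbitrary commutative ring, with denominators multiplied out and
-- truncation errors that are explicit multiples of z_{m+1}^T. Power series return only at the end,
-- to supply the inverses and to read off coefficients.

-- Finite sums in a commutative ring.

module FiniteSums {c ℓ} (R : CommutativeRing c ℓ) where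

  open CommutativeRing R
  open SetoidReasoning setoid
  open CommutativeSemigroupProperties +-commutativeSemigroup using (interchange)

  ∑ : {A : Set} → List A → (A → Carrier) → Carrier
  ∑ xs f = foldr _+_ 0# (map f xs)

  syntax ∑ xs (λ x → e) = ∑[ x ∈ xs ] e

  infixr 5 ∑

  ∑-cong : ∀ {A : Set} (xs : List A) {f g : A → Carrier} → (∀ x → f x ≈ g x) → ∑ xs f ≈ ∑ xs g
  ∑-cong []       p = refl
  ∑-cong (x ∷ xs) p = +-cong (p x) (∑-cong xs p)

  ∑-zero : ∀ {A : Set} (xs : List A) → ∑[ _ ∈ xs ] 0# ≈ 0#
  ∑-zero []       = refl
  ∑-zero (x ∷ xs) = trans (+-identityˡ _) (∑-zero xs)

  ∑-++ : ∀ {A : Set} (xs ys : List A) (f : A → Carrier) → ∑ (xs ++ ys) f ≈ ∑ xs f + ∑ ys f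
  ∑-++ []       ys f = sym (+-identityˡ _)
  ∑-++ (x ∷ xs) ys f = trans (+-congˡ (∑-++ xs ys f)) (sym (+-assoc _ _ _))

  ∑-map : ∀ {A B : Set} (h : A → B) xs (f : B → Carrier) → ∑ (map h xs) f ≈ ∑ xs (f ∘ h)
  ∑-map h []       f = refl
  ∑-map h (x ∷ xs) f = +-congˡ (∑-map h xs f)

  ∑-distrib-+ : ∀ {A : Set} (xs : List A) (f g : A → Carrier) →
    ∑[ x ∈ xs ] (f x + g x) ≈ ∑ xs f + ∑ xs g
  ∑-distrib-+ []       f g = sym (+-identityˡ _)
  ∑-distrib-+ (x ∷ xs) f g = trans (+-congˡ (∑-distrib-+ xs f g)) (interchange _ _ _ _)

  *-distribˡ-∑ : ∀ {A : Set} a (xs : List A) (f : A → Carrier) →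
    a * ∑ xs f ≈ ∑[ x ∈ xs ] (a * f x)
  *-distribˡ-∑ a []       f = zeroʳ a
  *-distribˡ-∑ a (x ∷ xs) f = trans (distribˡ _ _ _) (+-congˡ (*-distribˡ-∑ a xs f))

  ∑-comm : ∀ {A B : Set} (xs : List A) (ys : List B) (f : A → B → Carrier) →
    ∑[ x ∈ xs ] ∑[ y ∈ ys ] f x y ≈ ∑[ y ∈ ys ] ∑[ x ∈ xs ] f x y
  ∑-comm []       ys f = sym (∑-zero ys)
  ∑-comm (x ∷ xs) ys f = trans (+-congˡ (∑-comm xs ys f)) (sym (∑-distrib-+ ys (f x) _))

  ∑-cartesianProductWith : ∀ {A B C : Set} (h : A → B → C) xs ys (f : C → Carrier) →
    ∑ (cartesianProductWith h xs ys) f ≈ ∑[ x ∈ xs ] ∑[ y ∈ ys ] f (h x y)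
  ∑-cartesianProductWith h []       ys f = refl
  ∑-cartesianProductWith h (x ∷ xs) ys f = trans
    (∑-++ (map (h x) ys) _ f)
    (+-cong (∑-map (h x) ys f) (∑-cartesianProductWith h xs ys f))

  ∑-filter : ∀ {A : Set} {P : A → Set} (P? : Decidable P) xs (f : A → Carrier) →
    ∑ (filter P? xs) f ≈ ∑[ x ∈ xs ] (if does (P? x) then f x else 0#)
  ∑-filter P? []       f = refl
  ∑-filter P? (x ∷ xs) f with does (P? x)
  ... | true  = +-congˡ (∑-filter P? xs f)
  ... | false = trans (∑-filter P? xs f) (sym (+-identityˡ _))

  ∑-upTo-suc : ∀ n (f : ℕ → Carrier) → ∑ (upTo (suc n)) f ≈ f 0 + ∑ (upTo n) (f ∘ suc)
  ∑-upTo-suc n f = +-congˡ (trans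
    (reflexive (≡.cong (λ ys → ∑ ys f) (≡.sym (map-upTo suc n))))
    (∑-map suc (upTo n) f))

  ∑-upTo-last : ∀ n (f : ℕ → Carrier) → ∑ (upTo (suc n)) f ≈ ∑ (upTo n) f + f n
  ∑-upTo-last n f = begin
    ∑ (upTo (suc n)) f       ≡⟨ ≡.cong (λ ys → ∑ ys f) (≡.sym (upTo-∷ʳ n)) ⟩
    ∑ (upTo n ++ n ∷ []) f   ≈⟨ ∑-++ (upTo n) (n ∷ []) f ⟩
    ∑ (upTo n) f + (f n + 0#) ≈⟨ +-congˡ (+-identityʳ _) ⟩
    ∑ (upTo n) f + f n       ∎

-- Sequences under the Cauchy product.

module Cauchy {c ℓ} (R : CommutativeRing c ℓ) where

  open CommutativeRing R
  open SetoidReasoning setoid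
  open CommutativeSemigroupProperties +-commutativeSemigroup using (x∙yz≈y∙xz)

  open FiniteSums R

  infixl 7 _⊛_

  -- Peeling off the first coefficient of the left factor, instead of summing over a range, lets the
  -- ring laws be proved by induction on the index without reindexing double sums.
  _⊛_ : (ℕ → Carrier) → (ℕ → Carrier) → ℕ → Carrier
  (f ⊛ g) zero    = f 0 * g 0
  (f ⊛ g) (suc n) = f 0 * g (suc n) + (f ∘ suc ⊛ g) n

  constant : Carrier → ℕ → Carrier
  constant a zero    = a
  constant a (suc _) = 0#

  ⊛-cong : ∀ {f f′ g g′} → (∀ n → f n ≈ f′ n) → (∀ n → g n ≈ g′ n) →
    ∀ n → (f ⊛ g) n ≈ (f′ ⊛ g′) n
  ⊛-cong p q zero    = *-cong (p 0) (q 0)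
  ⊛-cong p q (suc n) = +-cong (*-cong (p 0) (q (suc n))) (⊛-cong (p ∘ suc) q n)

  ⊛-suc : ∀ f g n → (f ⊛ g) (suc n) ≈ f (suc n) * g 0 + (f ⊛ g ∘ suc) n
  ⊛-suc f g zero    = +-comm _ _
  ⊛-suc f g (suc n) = trans (+-congˡ (⊛-suc (f ∘ suc) g n)) (x∙yz≈y∙xz _ _ _)

  ⊛-comm : ∀ f g n → (f ⊛ g) n ≈ (g ⊛ f) n
  ⊛-comm f g zero    = *-comm _ _
  ⊛-comm f g (suc n) = trans (+-cong (*-comm _ _) (⊛-comm (f ∘ suc) g n)) (sym (⊛-suc g f n))

  ⊛-zeroˡ : ∀ g n → ((λ _ → 0#) ⊛ g) n ≈ 0#
  ⊛-zeroˡ g zero    = zeroˡ _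
  ⊛-zeroˡ g (suc n) = trans (+-cong (zeroˡ _) (⊛-zeroˡ g n)) (+-identityˡ _)

  constant-⊛ : ∀ a g n → (constant a ⊛ g) n ≈ a * g n
  constant-⊛ a g zero    = refl
  constant-⊛ a g (suc n) = trans (+-congˡ (⊛-zeroˡ g n)) (+-identityʳ _)

  ⊛-distribʳ-+ : ∀ h f g n → ((λ i → f i + g i) ⊛ h) n ≈ (f ⊛ h) n + (g ⊛ h) n
  ⊛-distribʳ-+ h f g zero    = distribʳ _ _ _
  ⊛-distribʳ-+ h f g (suc n) = trans
    (+-cong (distribʳ _ _ _) (⊛-distribʳ-+ h (f ∘ suc) (g ∘ suc) n))
    (interchange _ _ _ _)
    where open CommutativeSemigroupProperties +-commutativeSemigroup using (interchange)

  ⊛-scaleˡ : ∀ a f g n → ((λ i → a * f i) ⊛ g) n ≈ a * (f ⊛ g) n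
  ⊛-scaleˡ a f g zero    = *-assoc _ _ _
  ⊛-scaleˡ a f g (suc n) =
    trans (+-cong (*-assoc _ _ _) (⊛-scaleˡ a (f ∘ suc) g n)) (sym (distribˡ _ _ _))

  ⊛-assoc : ∀ f g h n → (f ⊛ g ⊛ h) n ≈ (f ⊛ (g ⊛ h)) n
  ⊛-assoc f g h zero    = *-assoc _ _ _
  ⊛-assoc f g h (suc n) = begin
    f 0 * g 0 * h (suc n) + ((λ k → f 0 * g (suc k) + (f ∘ suc ⊛ g) k) ⊛ h) n
      ≈⟨ +-cong (*-assoc _ _ _) (⊛-distribʳ-+ h (λ k → f 0 * g (suc k)) (f ∘ suc ⊛ g) n) ⟩
    f 0 * (g 0 * h (suc n)) + (((λ k → f 0 * g (suc k)) ⊛ h) n + (f ∘ suc ⊛ g ⊛ h) n)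
      ≈⟨ +-congˡ (+-cong (⊛-scaleˡ (f 0) (g ∘ suc) h n) (⊛-assoc (f ∘ suc) g h n)) ⟩
    f 0 * (g 0 * h (suc n)) + (f 0 * (g ∘ suc ⊛ h) n + (f ∘ suc ⊛ (g ⊛ h)) n)
      ≈⟨ sym (+-assoc _ _ _) ⟩
    f 0 * (g 0 * h (suc n)) + f 0 * (g ∘ suc ⊛ h) n + (f ∘ suc ⊛ (g ⊛ h)) n
      ≈⟨ +-congʳ (sym (distribˡ _ _ _)) ⟩
    f 0 * (g ⊛ h) (suc n) + (f ∘ suc ⊛ (g ⊛ h)) n ∎

  sequenceRing : CommutativeRing c ℓ
  sequenceRing = record
    { Carrier = ℕ → Carrier
    ; _≈_ = λ f g → ∀ n → f n ≈ g n
    ; _+_ = λ f g n → f n + g n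
    ; _*_ = _⊛_
    ; -_  = λ f n → - f n
    ; 0#  = λ _ → 0#
    ; 1#  = constant 1#
    ; isCommutativeRing = record
      { isRing = record
        { +-isAbelianGroup = record
          { isGroup = record
            { isMonoid = record
              { isSemigroup = record
                { isMagma = record
                  { isEquivalence = record
                    { refl = λ _ → refl
                    ; sym = λ p n → sym (p n)
                    ; trans = λ p q n → trans (p n) (q n)
                    }
                  ; ∙-cong = λ p q n → +-cong (p n) (q n)
                  }
                ; assoc = λ f g h n → +-assoc (f n) (g n) (h n)
                }
              ; identity = (λ f n → +-identityˡ (f n)) , (λ f n → +-identityʳ (f n))
              }
            ; inverse = (λ f n → -‿inverseˡ (f n)) , (λ f n → -‿inverseʳ (f n))
            ; ⁻¹-cong = λ p n → -‿cong (p n)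
            }
          ; comm = λ f g n → +-comm (f n) (g n)
          }
        ; *-cong = ⊛-cong
        ; *-assoc = ⊛-assoc
        ; *-identity = ⊛-identityˡ ,
            λ f n → trans (⊛-comm f (constant 1#) n) (⊛-identityˡ f n)
        ; distrib =
            (λ f g h n → trans (⊛-comm f (λ i → g i + h i) n)
              (trans (⊛-distribʳ-+ f g h n) (+-cong (⊛-comm g f n) (⊛-comm h f n)))) ,
            ⊛-distribʳ-+
        }
      ; *-comm = ⊛-comm
      }
    }
    where
    ⊛-identityˡ : ∀ f n → (constant 1# ⊛ f) n ≈ f n
    ⊛-identityˡ f n = trans (constant-⊛ 1# f n) (*-identityˡ _)

  ⊛-as-∑ : ∀ f g n → (f ⊛ g) n ≈ ∑[ b ∈ upTo (suc n) ] (f b * g (n ∸ b))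
  ⊛-as-∑ f g zero    = sym (+-identityʳ _)
  ⊛-as-∑ f g (suc n) = trans (+-congˡ (⊛-as-∑ (f ∘ suc) g n))
    (sym (∑-upTo-suc (suc n) (λ b → f b * g (suc n ∸ b))))

-- The commutative ring of formal power series.

module SeriesRing where

  open PowerSeries using (Series; rawRing)

  -- By induction on the number of variables: a series in N + 1 variables is a sequence of series in
  -- N variables, multiplied by the Cauchy product, so the laws are pulled back along the injective
  -- `curry`. With no variables only a constant term in ℤ is left.
  series-isCommutativeRing : ∀ N → let open PowerSeries N in
    IsCommutativeRing _≈_ _+_ _*_ -_ 0# 1#
  series-isCommutativeRing zero = RingMonomorphism.isCommutativeRing constantTerm CR.isCommutativeRing
    where
    module CR = CommutativeRing ℤ.+-*-commutativeRing
    constantTerm : IsRingMonomorphism (rawRing 0) CR.rawRing (λ f → f [])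
    constantTerm = record
      { isRingHomomorphism = record
        { isSemiringHomomorphism = record
          { isNearSemiringHomomorphism = record
            { +-isMonoidHomomorphism = record
              { isMagmaHomomorphism = record
                { isRelHomomorphism = record { cong = λ p → p [] }
                ; homo = λ _ _ → ≡.refl
                }
              ; ε-homo = ≡.refl
              }
            ; *-homo = λ f g → ℤ.+-identityʳ _
            }
          ; 1#-homo = ≡.refl
          }
        ; -‿homo = λ _ → ≡.refl
        }
      ; injective = λ { p [] → p }
      }
  series-isCommutativeRing (suc N) = RingMonomorphism.isCommutativeRing curried (CommutativeRing.isCommutativeRing C.sequenceRing)
    where
    S : CommutativeRing _ _
    S = record { isCommutativeRing = series-isCommutativeRing N }
    module C = Cauchy S
    module FS = FiniteSums S
    open FiniteSums ℤ.+-*-commutativeRing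
    ∑-evaluate : ∀ {A : Set} (xs : List A) (f : A → Series N) α → FS.∑ xs f α ≡ ∑ xs (λ x → f x α)
    ∑-evaluate []       f α = ≡.refl
    ∑-evaluate (x ∷ xs) f α = ≡.cong (ℤ._+_ (f x α)) (∑-evaluate xs f α)
    curry : Series (suc N) → ℕ → Series N
    curry f a α = f (a ∷ α)
    *-homo : ∀ f g a α → curry (PowerSeries._*_ (suc N) f g) a α ≡ C._⊛_ (curry f) (curry g) a α
    *-homo f g a α = ≡.trans
      (∑-cartesianProductWith _∷_ (upTo (suc a)) (below α) (λ β → f β ℤ.* g (Vec.zipWith _∸_ (a ∷ α) β)))
      (≡.sym (≡.trans (C.⊛-as-∑ (curry f) (curry g) a α)
      (∑-evaluate (upTo (suc a)) (λ b → PowerSeries._*_ N (curry f b) (curry g (a ∸ b))) α)))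
    1#-homo : ∀ a α → curry (PowerSeries.1# (suc N)) a α ≡ C.constant (PowerSeries.1# N) a α
    1#-homo zero    α = ≡.refl
    1#-homo (suc a) α = ≡.refl
    curried : IsRingMonomorphism (rawRing (suc N)) (CommutativeRing.rawRing C.sequenceRing) curry
    curried = record
      { isRingHomomorphism = record
        { isSemiringHomomorphism = record
          { isNearSemiringHomomorphism = record
            { +-isMonoidHomomorphism = record
              { isMagmaHomomorphism = record
                { isRelHomomorphism = record { cong = λ p a α → p (a ∷ α) }
                ; homo = λ _ _ _ _ → ≡.refl
                }
              ; ε-homo = λ _ _ → ≡.refl
              }
            ; *-homo = *-homo
            }
          ; 1#-homo = 1#-homo
          }
        ; -‿homo = λ _ _ _ → ≡.refl
        }
      ; injective = λ { p (a ∷ α) → p a α }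
      }

  seriesRing : ℕ → CommutativeRing _ _
  seriesRing N = record { isCommutativeRing = series-isCommutativeRing N }

-- Finite geometric sums.

module Geometric {c ℓ} (R : CommutativeRing c ℓ) where

  open CommutativeRing R
  open RingProperties ring
  open FiniteSums R
  open CommutativeSemiringExp commutativeSemiring using (_^_)
  open SetoidReasoning setoid

  1-[1-x]≈x : ∀ x → 1# - (1# - x) ≈ x
  1-[1-x]≈x x = begin
    1# + - (1# + - x)     ≈⟨ +-congˡ (sym (-‿+-comm _ _)) ⟩
    1# + (- 1# + - - x)   ≈⟨ sym (+-assoc _ _ _) ⟩
    1# + - 1# + - - x     ≈⟨ +-cong (-‿inverseʳ 1#) (-‿involutive x) ⟩
    0# + x                ≈⟨ +-identityˡ x ⟩
    x                     ∎

  [1-x]+x[1-y]≈1-xy : ∀ x y → (1# - x) + x * (1# - y) ≈ 1# - x * y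
  [1-x]+x[1-y]≈1-xy x y = begin
    (1# - x) + x * (1# - y)      ≈⟨ +-congˡ (x[y-z]≈xy-xz x 1# y) ⟩
    (1# - x) + (x * 1# - x * y)  ≈⟨ +-congˡ (+-congʳ (*-identityʳ x)) ⟩
    (1# - x) + (x - x * y)       ≈⟨ +-assoc _ _ _ ⟩
    1# + (- x + (x - x * y))     ≈⟨ +-congˡ (\\-leftDividesʳ x _) ⟩
    1# - x * y                   ∎

  x*y≈x[y-z]+xz : ∀ x y z → x * y ≈ x * (y - z) + x * z
  x*y≈x[y-z]+xz x y z = trans (*-congˡ (sym (//-rightDividesˡ z y))) (distribˡ _ _ _)

  *-geometric : ∀ f J → f * ∑ (upTo J) ((1# - f) ^_) ≈ 1# - (1# - f) ^ J
  *-geometric f zero    = trans (zeroʳ f) (sym (-‿inverseʳ 1#))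
  *-geometric f (suc J) = begin
    f * ∑ (upTo (suc J)) (g ^_)         ≈⟨ *-congˡ (∑-upTo-last J (g ^_)) ⟩
    f * (∑ (upTo J) (g ^_) + g ^ J)     ≈⟨ distribˡ _ _ _ ⟩
    f * ∑ (upTo J) (g ^_) + f * g ^ J   ≈⟨ +-congʳ (*-geometric f J) ⟩
    1# - g ^ J + f * g ^ J              ≈⟨ +-assoc _ _ _ ⟩
    1# + (- (g ^ J) + f * g ^ J)        ≈⟨ +-congˡ (begin
      - (g ^ J) + f * g ^ J         ≈⟨ +-congˡ (sym (-‿involutive _)) ⟩
      - (g ^ J) + - - (f * g ^ J)   ≈⟨ -‿+-comm _ _ ⟩
      - (g ^ J - f * g ^ J)         ≈⟨ -‿cong (+-congʳ (sym (*-identityˡ _))) ⟩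
      - (1# * g ^ J - f * g ^ J)    ≈⟨ -‿cong (sym ([y-z]x≈yx-zx _ _ _)) ⟩
      - (g * g ^ J)                 ∎) ⟩
    1# - g ^ suc J                      ∎
    where
    g : Carrier
    g = 1# - f

-- Congruence modulo a principal ideal.

module Congruence {c ℓ} (R : CommutativeRing c ℓ) (p : CommutativeRing.Carrier R) where

  open CommutativeRing R
  open FiniteSums R
  open SetoidReasoning setoid
  open CommutativeSemigroupProperties *-commutativeSemigroup using (x∙yz≈y∙xz)
  open CommutativeSemigroupProperties +-commutativeSemigroup using (interchange)

  infix 4 _∼_

  -- The cofactor `h` is kept as a witness: applied with p = w^T, it displays the error of a
  -- truncation as a multiple of w^T.
  _∼_ : Carrier → Carrier → Set _
  f ∼ g = ∃ λ h → f ≈ g + p * h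

  ∼-reflexive : ∀ {f g} → f ≈ g → f ∼ g
  ∼-reflexive f≈g = 0# , trans f≈g (sym (trans (+-congˡ (zeroʳ p)) (+-identityʳ _)))

  ∼-trans : ∀ {f g h} → f ∼ g → g ∼ h → f ∼ h
  ∼-trans {f} {g} {h} (a , f∼g) (b , g∼h) = b + a , (begin
    f                     ≈⟨ f∼g ⟩
    g + p * a             ≈⟨ +-congʳ g∼h ⟩
    h + p * b + p * a     ≈⟨ +-assoc _ _ _ ⟩
    h + (p * b + p * a)   ≈⟨ +-congˡ (sym (distribˡ _ _ _)) ⟩
    h + p * (b + a)       ∎)

  ∼-+ : ∀ {f g h k} → f ∼ g → h ∼ k → f + h ∼ g + k
  ∼-+ (a , f∼g) (b , h∼k) = a + b , trans (+-cong f∼g h∼k)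
    (trans (interchange _ _ _ _) (+-congˡ (sym (distribˡ _ _ _))))

  ∼-*ˡ : ∀ e {f g} → f ∼ g → e * f ∼ e * g
  ∼-*ˡ e (a , f∼g) = e * a , trans (*-congˡ f∼g) (trans (distribˡ _ _ _) (+-congˡ (x∙yz≈y∙xz _ _ _)))

  ∼-∑ : ∀ {A : Set} (xs : List A) {f g : A → Carrier} → (∀ a → f a ∼ g a) → ∑ xs f ∼ ∑ xs g
  ∼-∑ []       p = ∼-reflexive refl
  ∼-∑ (a ∷ xs) p = ∼-+ (p a) (∼-∑ xs p)

-- The degree filtration and inverses of power series.

below-sum : ∀ {N} (α : Vec ℕ N) {β} → β ∈ below α → Vec.sum β ℕ.+ Vec.sum (Vec.zipWith _∸_ α β) ≡ Vec.sum α
below-sum []      (here ≡.refl) = ≡.refl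
below-sum (a ∷ α) p with ∈-cartesianProductWith⁻ _∷_ (upTo (suc a)) (below α) p
... | b , β , b∈ , β∈ , ≡.refl = ≡.trans (interchange b (Vec.sum β) (a ∸ b) _)
  (≡.cong₂ ℕ._+_ (ℕ.m+[n∸m]≡n (ℕ.≤-pred (∈-upTo⁻ b∈))) (below-sum α β∈))
  where open CommutativeSemigroupProperties ℕ.+-commutativeSemigroup using (interchange)

module Vanishing (N : ℕ) where

  open CommutativeRing (SeriesRing.seriesRing N) hiding (zero)
  open RingProperties ring
  open PowerSeries N using (Series; X; _⁻¹)
  open FiniteSums (SeriesRing.seriesRing N)
  open Geometric (SeriesRing.seriesRing N)
  open CommutativeSemiringExp commutativeSemiring using (_^_)
  open RawSemiringDefinitions (Semiring.rawSemiring semiring) using (product)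
  module Z = FiniteSums ℤ.+-*-commutativeRing

  -- The order of `f` is at least `d`. A bound on the order makes high powers of `1# - f` and
  -- multiples of w^T invisible at a given exponent.
  Vanish : ℕ → Series → Set
  Vanish d f = ∀ α → Vec.sum α < d → f α ≡ 0ℤ

  vanish-resp : ∀ {d f g} → f ≈ g → Vanish d f → Vanish d g
  vanish-resp f≈g v α α<d = ≡.trans (≡.sym (f≈g α)) (v α α<d)

  vanish-0 : ∀ {f} → Vanish 0 f
  vanish-0 α ()

  vanish-+ : ∀ {d f g} → Vanish d f → Vanish d g → Vanish d (f + g)
  vanish-+ v u α α<d = ≡.cong₂ ℤ._+_ (v α α<d) (u α α<d)

  -- Every term pairs exponents whose degrees add up to less than d + e, so one of its two factors
  -- lies below its own bound.
  vanish-* : ∀ {d e f g} → Vanish d f → Vanish e g → Vanish (d ℕ.+ e) (f * g)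
  vanish-* {d} {e} {f} {g} v u α α<d+e = sum-zero (below α) (term _)
    where
    sum-zero : ∀ xs → (∀ {β} → β ∈ xs → f β ℤ.* g (Vec.zipWith _∸_ α β) ≡ 0ℤ) →
      Z.∑ xs (λ β → f β ℤ.* g (Vec.zipWith _∸_ α β)) ≡ 0ℤ
    sum-zero []       p = ≡.refl
    sum-zero (β ∷ xs) p = ≡.cong₂ ℤ._+_ (p (here ≡.refl)) (sum-zero xs (p ∘ there))
    term : ∀ β → β ∈ below α → f β ℤ.* g (Vec.zipWith _∸_ α β) ≡ 0ℤ
    term β β∈ with Vec.sum β ℕ.<? d
    ... | yes β<d = ≡.trans (≡.cong (ℤ._* g (Vec.zipWith _∸_ α β)) (v β β<d)) (ℤ.*-zeroˡ (g (Vec.zipWith _∸_ α β)))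
    ... | no  β≮d = ≡.trans (≡.cong (ℤ._*_ (f β)) (u _ rest<e)) (ℤ.*-zeroʳ (f β))
      where
      rest<e : Vec.sum (Vec.zipWith _∸_ α β) < e
      rest<e = ℕ.+-cancelˡ-< d _ _ (ℕ.≤-<-trans (ℕ.+-monoˡ-≤ _ (ℕ.≮⇒≥ β≮d))
        (≡.subst (_< d ℕ.+ e) (≡.sym (below-sum α β∈)) α<d+e))

  vanish-*ˡ : ∀ {d g} f → Vanish d g → Vanish d (f * g)
  vanish-*ˡ {g = g} f v = vanish-* {f = f} {g = g} (vanish-0 {f}) v

  vanish-*ʳ : ∀ {d f} g → Vanish d f → Vanish d (f * g)
  vanish-*ʳ {f = f} g v = vanish-resp {f = g * f} {g = f * g} (*-comm g f) (vanish-*ˡ g v)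

  vanish-^ : ∀ {f} → Vanish 1 f → ∀ j → Vanish j (f ^ j)
  vanish-^ {f} v zero    = vanish-0 {f ^ 0}
  vanish-^ {f} v (suc j) = vanish-* {f = f} {g = f ^ j} v (vanish-^ {f} v j)

  vanish-^suc : ∀ {f} → Vanish 1 f → ∀ j → Vanish 1 (f ^ suc j)
  vanish-^suc {f} v j = vanish-*ʳ {f = f} (f ^ j) v

  vanish-X : ∀ i → Vanish 1 (X i)
  vanish-X i α α<1 with Vec.≡-dec ℕ._≟_ (Vec.replicate N 0 Vec.[ i ]≔ 1) α
  ... | yes ≡.refl = contradiction α<1 (ℕ.≤⇒≯ (unit-sum i))
    where
    unit-sum : ∀ {N} (i : Fin N) → 1 ≤ Vec.sum (Vec.replicate N 0 Vec.[ i ]≔ 1)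
    unit-sum zero    = s≤s z≤n
    unit-sum (suc i) = unit-sum i
  ... | no _ = ≡.refl

  -- Constant coefficient 1, phrased through the order so that `vanish-^` bounds the terms of the
  -- geometric series.
  OneMod : Series → Set
  OneMod f = Vanish 1 (1# - f)

  oneMod-1-x : ∀ {f} → Vanish 1 f → OneMod (1# - f)
  oneMod-1-x {f} v = vanish-resp {f = f} {g = 1# - (1# - f)} (sym {1# - (1# - f)} {f} (1-[1-x]≈x f)) v

  oneMod-* : ∀ {f g} → OneMod f → OneMod g → OneMod (f * g)
  oneMod-* {f} {g} v u = vanish-resp {f = (1# - f) + f * (1# - g)} {g = 1# - f * g} ([1-x]+x[1-y]≈1-xy f g)
    (vanish-+ {f = 1# - f} {g = f * (1# - g)} v (vanish-*ˡ f u))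

  oneMod-1 : OneMod 1#
  oneMod-1 α _ = -‿inverseʳ 1# α

  oneMod-product : ∀ {n} (f : Fin n → Series) → (∀ i → OneMod (f i)) → OneMod (product f)
  oneMod-product {zero}  f v = oneMod-1
  oneMod-product {suc n} f v =
    oneMod-* {f = f zero} {g = product (f ∘ suc)} (v zero) (oneMod-product (f ∘ suc) (v ∘ suc))

  private
    geometric : Series → ℕ → Series
    geometric f J = ∑ (upTo J) ((1# - f) ^_)

  geometric-stable : ∀ f → OneMod f → ∀ d α → geometric f (d ℕ.+ suc (Vec.sum α)) α ≡ (f ⁻¹) α
  geometric-stable f v zero    α = ≡.refl
  geometric-stable f v (suc d) α = ≡.trans (∑-upTo-last J ((1# - f) ^_) α)
    (≡.trans (≡.cong (ℤ._+_ (geometric f J α)) (vanish-^ {1# - f} v J α (ℕ.m≤n+m _ d)))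
    (≡.trans (ℤ.+-identityʳ _) (geometric-stable f v d α)))
    where
    J : ℕ
    J = d ℕ.+ suc (Vec.sum α)

  -- The cut-off in the definition of `⁻¹` moves with the exponent. Up to order J it may be frozen,
  -- and the telescoping of `*-geometric` applies to the resulting partial sum.
  vanish-⁻¹-geometric : ∀ f → OneMod f → ∀ J → Vanish J (f ⁻¹ - geometric f J)
  vanish-⁻¹-geometric f v J α α<J = ≡.trans
    (≡.cong (λ x → (f ⁻¹) α ℤ.- x) (≡.trans (≡.cong (λ K → geometric f K α) (≡.sym (ℕ.m∸n+n≡m α<J)))
      (geometric-stable f v (J ∸ suc (Vec.sum α)) α)))
    (ℤ.+-inverseʳ ((f ⁻¹) α))

  *-⁻¹ : ∀ f → OneMod f → f * f ⁻¹ ≈ 1#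
  *-⁻¹ f v α = ≡.trans (x*y≈x[y-z]+xz f (f ⁻¹) (geometric f J) α) (≡.trans
    (≡.cong₂ ℤ._+_ (vanish-*ˡ f (vanish-⁻¹-geometric f v J) α ℕ.≤-refl)
      (≡.trans (*-geometric f J α) (≡.cong (λ x → 1# α ℤ.- x) (vanish-^ {1# - f} v J α ℕ.≤-refl))))
    (≡.trans (ℤ.+-identityˡ _) (ℤ.+-identityʳ (1# α))))
    where
    J : ℕ
    J = suc (Vec.sum α)

  -- The way out of the congruences: a multiple of `w ^ T` has order at least T.
  coefficient-∼ : ∀ {w f g} → Vanish 1 w → ∀ T α → Vec.sum α < T →
    Congruence._∼_ (SeriesRing.seriesRing N) (w ^ T) f g → f α ≡ g α
  coefficient-∼ {w} {f} {g} vanish-w T α α<T (h , f≈g+wᵀh) = ≡.trans (f≈g+wᵀh α) (≡.trans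
    (≡.cong (ℤ._+_ (g α)) (vanish-*ʳ {f = w ^ T} h (vanish-^ {w} vanish-w T) α α<T))
    (ℤ.+-identityʳ (g α)))

-- Finite products.

module Products {c ℓ} (R : CommutativeRing c ℓ) where

  open CommutativeRing R hiding (zero)
  open RawSemiringDefinitions (Semiring.rawSemiring semiring) using (product)
  open SetoidReasoning setoid
  open CommutativeSemigroupProperties *-commutativeSemigroup using (x∙yz≈y∙xz)

  product-cong : ∀ {n} {f g : Fin n → Carrier} → (∀ i → f i ≈ g i) → product f ≈ product g
  product-cong {zero}  p = refl
  product-cong {suc n} p = *-cong (p zero) (product-cong (p ∘ suc))

  product-toℕ-last : ∀ (f : ℕ → Carrier) n →
    product {suc n} (f ∘ toℕ) ≈ product {n} (f ∘ toℕ) * f n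
  product-toℕ-last f zero    = *-comm _ _
  product-toℕ-last f (suc n) = trans (*-congˡ (product-toℕ-last (f ∘ suc) n)) (sym (*-assoc _ _ _))

  product-1 : ∀ {n} {f : Fin n → Carrier} → (∀ i → f i ≈ 1#) → product f ≈ 1#
  product-1 {zero}  p = refl
  product-1 {suc n} p = trans (*-cong (p zero) (product-1 (p ∘ suc))) (*-identityˡ _)

  product-0 : ∀ {n} {f : Fin n → Carrier} k → f k ≈ 0# → product f ≈ 0#
  product-0 zero    p = trans (*-congʳ p) (zeroˡ _)
  product-0 (suc k) p = trans (*-congˡ (product-0 k p)) (zeroʳ _)

  product-scale : ∀ {n} (f g : Fin n → Carrier) a k →
    f k ≈ a * g k → (∀ j → j ≢ k → f j ≈ g j) → product f ≈ a * product g
  product-scale f g a zero    p q = trans (*-cong p (product-cong λ j → q (suc j) λ ())) (*-assoc _ _ _)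
  product-scale f g a (suc k) p q = trans
    (*-cong (q zero λ ()) (product-scale (f ∘ suc) (g ∘ suc) a k p (λ j j≢k → q (suc j) (j≢k ∘ Fin.suc-injective))))
    (x∙yz≈y∙xz _ _ _)

  -- A product is linear in each single factor. This serves twice: for the colours, in the ring of
  -- sequences, and for the letters, in R itself.
  product-affine : ∀ {n} (f f₁ f₂ : Fin n → Carrier) a k →
    f k ≈ f₁ k + a * f₂ k → (∀ j → j ≢ k → f j ≈ f₁ j) → (∀ j → j ≢ k → f j ≈ f₂ j) →
    product f ≈ product f₁ + a * product f₂
  product-affine f f₁ f₂ a zero p p₁ p₂ = begin
    f zero * product (f ∘ suc)
      ≈⟨ *-congʳ p ⟩
    (f₁ zero + a * f₂ zero) * product (f ∘ suc)
      ≈⟨ distribʳ _ _ _ ⟩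
    f₁ zero * product (f ∘ suc) + a * f₂ zero * product (f ∘ suc)
      ≈⟨ +-cong (*-congˡ (product-cong λ j → p₁ (suc j) λ ()))
        (trans (*-assoc _ _ _) (*-congˡ (*-congˡ (product-cong λ j → p₂ (suc j) λ ())))) ⟩
    product f₁ + a * product f₂ ∎
  product-affine f f₁ f₂ a (suc k) p p₁ p₂ = begin
    f zero * product (f ∘ suc)
      ≈⟨ *-congˡ (product-affine (f ∘ suc) (f₁ ∘ suc) (f₂ ∘ suc) a k p
        (λ j j≢k → p₁ (suc j) (j≢k ∘ Fin.suc-injective)) (λ j j≢k → p₂ (suc j) (j≢k ∘ Fin.suc-injective))) ⟩
    f zero * (product (f₁ ∘ suc) + a * product (f₂ ∘ suc))
      ≈⟨ distribˡ _ _ _ ⟩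
    f zero * product (f₁ ∘ suc) + f zero * (a * product (f₂ ∘ suc))
      ≈⟨ +-cong (*-congʳ (p₁ zero λ ())) (trans (x∙yz≈y∙xz _ _ _) (*-congˡ (*-congʳ (p₂ zero λ ())))) ⟩
    product f₁ + a * product f₂ ∎

-- Complete homogeneous polynomials of a geometric progression.

module Homogeneous {c ℓ} (R : CommutativeRing c ℓ) where

  open CommutativeRing R hiding (zero)
  open FiniteSums R
  open Geometric R
  open Products R
  open CommutativeSemiringExp commutativeSemiring using (_^_; ^-homo-*; ^-congʳ)
  open RawSemiringDefinitions (Semiring.rawSemiring semiring) using (product)
  open CommutativeMonoidSum *-commutativeMonoid using () renaming (∑-distrib-+ to product-distrib-*)
  open CommutativeSemigroupProperties *-commutativeSemigroup using (x∙yz≈y∙xz; interchange)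
  open SetoidReasoning setoid

  -- The complete homogeneous symmetric polynomials h_M(Y), M ≥ 0.
  hom : List Carrier → ℕ → Carrier
  hom []      zero    = 1#
  hom []      (suc M) = 0#
  hom (ω ∷ Y) zero    = 1#
  hom (ω ∷ Y) (suc M) = hom Y (suc M) + ω * hom (ω ∷ Y) M

  hom-zero : ∀ Y → hom Y 0 ≈ 1#
  hom-zero []      = refl
  hom-zero (ω ∷ Y) = refl

  hom-scale : ∀ q Y M → hom (map (q *_) Y) M ≈ q ^ M * hom Y M
  hom-scale q []      zero    = sym (*-identityˡ _)
  hom-scale q []      (suc M) = sym (zeroʳ _)
  hom-scale q (ω ∷ Y) zero    = sym (*-identityˡ _)
  hom-scale q (ω ∷ Y) (suc M) = begin
    hom (map (q *_) Y) (suc M) + q * ω * hom (map (q *_) (ω ∷ Y)) M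
      ≈⟨ +-cong (hom-scale q Y (suc M)) (*-congˡ (hom-scale q (ω ∷ Y) M)) ⟩
    q ^ suc M * hom Y (suc M) + q * ω * (q ^ M * hom (ω ∷ Y) M)
      ≈⟨ +-congˡ (interchange _ _ _ _) ⟩
    q ^ suc M * hom Y (suc M) + q ^ suc M * (ω * hom (ω ∷ Y) M)
      ≈⟨ sym (distribˡ _ _ _) ⟩
    q ^ suc M * hom (ω ∷ Y) (suc M) ∎

  -- Scaling the whole tail, rather than advancing `y`, matches both the homogeneity of `hom` and
  -- the shift of slots by one level.
  progression : Carrier → Carrier → ℕ → List Carrier
  progression y q zero    = []
  progression y q (suc c) = y ∷ map (q *_) (progression y q c)

  module _ (y q : Carrier) where

    private
      -- The q-Pochhammer symbol (q^c; q)_M.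
      factors : ℕ → ℕ → Carrier
      factors c M = product {M} (λ i → 1# - q ^ (c ℕ.+ toℕ i))

      factors-first : ∀ c M → factors c (suc M) ≈ (1# - q ^ c) * factors (suc c) M
      factors-first c M = *-cong
        (reflexive (≡.cong (λ e → 1# - q ^ e) (ℕ.+-identityʳ c)))
        (product-cong {M} λ i → reflexive (≡.cong (λ e → 1# - q ^ e) (ℕ.+-suc c (toℕ i))))

      factors-last : ∀ c M → factors c (suc M) ≈ factors c M * (1# - q ^ (c ℕ.+ M))
      factors-last c M = product-toℕ-last (λ i → 1# - q ^ (c ℕ.+ i)) M

      -- The evaluation of h_M(y, ..., y q^(c-1)) as y^M times a q-binomial, with the denominator
      -- (q; q)_M cleared so that it makes sense for every q. Without its first term the progression
      -- is a scaled shorter one, which costs a power of q by homogeneity; the terms with and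
      -- without `y` then share a common factor.
      hom-factors : ∀ c M → hom (progression y q c) M * factors 1 M ≈ y ^ M * factors c M
      hom-factors zero    zero    = refl
      hom-factors (suc c) zero    = refl
      hom-factors zero    (suc M) = begin
        0# * factors 1 (suc M)                       ≈⟨ zeroˡ _ ⟩
        0#                                           ≈⟨ sym (zeroʳ _) ⟩
        y ^ suc M * 0#                               ≈⟨ *-congˡ (sym (zeroˡ _)) ⟩
        -- The vanishing factor is 1 - q^0. This is how the q-binomial becomes 0 when its upper
        -- entry is one less than the lower.
        y ^ suc M * (0# * factors 1 M)               ≈⟨ *-congˡ (*-congʳ (sym (-‿inverseʳ _))) ⟩
        y ^ suc M * ((1# - 1#) * factors 1 M)        ≈⟨ *-congˡ (sym (factors-first 0 M)) ⟩
        y ^ suc M * factors 0 (suc M)                ∎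
      hom-factors (suc c) (suc M) = begin
        (hom (map (q *_) (progression y q c)) (suc M) + y * h) * factors 1 (suc M)
          ≈⟨ distribʳ _ _ _ ⟩
        hom (map (q *_) (progression y q c)) (suc M) * factors 1 (suc M) + y * h * factors 1 (suc M)
          ≈⟨ +-cong fromTail fromHead ⟩
        y ^ suc M * F * (p * (1# - q ^ c)) + y ^ suc M * F * (1# - p)
          ≈⟨ sym (distribˡ _ _ _) ⟩
        y ^ suc M * F * (p * (1# - q ^ c) + (1# - p))
          -- The q-Pascal rule: p (1 - q^c) + (1 - p) = 1 - p q^c.
          ≈⟨ *-congˡ (trans (+-comm _ _) ([1-x]+x[1-y]≈1-xy p (q ^ c))) ⟩
        y ^ suc M * F * (1# - p * q ^ c)
          ≈⟨ *-congˡ (+-congˡ (-‿cong (trans (*-comm _ _) (trans (sym (^-homo-* q c (suc M)))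
            (^-congʳ q (ℕ.+-suc c M)))))) ⟩
        y ^ suc M * F * (1# - q ^ (suc c ℕ.+ M))
          ≈⟨ trans (*-assoc _ _ _) (*-congˡ (sym (factors-last (suc c) M))) ⟩
        y ^ suc M * factors (suc c) (suc M) ∎
        where
        h F p : Carrier
        h = hom (progression y q (suc c)) M
        F = factors (suc c) M
        p = q ^ suc M
        fromTail : hom (map (q *_) (progression y q c)) (suc M) * factors 1 (suc M)
          ≈ y ^ suc M * F * (p * (1# - q ^ c))
        fromTail = begin
          hom (map (q *_) (progression y q c)) (suc M) * factors 1 (suc M)
            ≈⟨ *-congʳ (hom-scale q (progression y q c) (suc M)) ⟩
          p * hom (progression y q c) (suc M) * factors 1 (suc M)
            ≈⟨ trans (*-assoc _ _ _) (*-congˡ (hom-factors c (suc M))) ⟩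
          p * (y ^ suc M * factors c (suc M))
            ≈⟨ *-congˡ (*-congˡ (trans (factors-first c M) (*-comm _ _))) ⟩
          p * (y ^ suc M * (F * (1# - q ^ c)))
            ≈⟨ *-congˡ (sym (*-assoc _ _ _)) ⟩
          p * (y ^ suc M * F * (1# - q ^ c))
            ≈⟨ x∙yz≈y∙xz _ _ _ ⟩
          y ^ suc M * F * (p * (1# - q ^ c)) ∎
        fromHead : y * h * factors 1 (suc M) ≈ y ^ suc M * F * (1# - p)
        fromHead = begin
          y * h * factors 1 (suc M)            ≈⟨ *-congˡ (factors-last 1 M) ⟩
          y * h * (factors 1 M * (1# - p))     ≈⟨ sym (*-assoc _ _ _) ⟩
          y * h * factors 1 M * (1# - p)       ≈⟨ *-congʳ (*-assoc _ _ _) ⟩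
          y * (h * factors 1 M) * (1# - p)     ≈⟨ *-congʳ (*-congˡ (hom-factors (suc c) M)) ⟩
          y * (y ^ M * F) * (1# - p)           ≈⟨ *-congʳ (sym (*-assoc _ _ _)) ⟩
          y ^ suc M * F * (1# - p)             ∎

    hom-progression : (inv : ℕ → Carrier) → (∀ i → (1# - q ^ suc i) * inv i ≈ 1#) → ∀ c M →
      hom (progression y q c) M ≈
        y ^ M * product {M} (λ i → (1# - q ^ (c ℕ.+ toℕ i)) * inv (toℕ i))
    hom-progression inv inverse c M = begin
      hom (progression y q c) M
        ≈⟨ sym (*-identityʳ _) ⟩
      hom (progression y q c) M * 1#
        ≈⟨ *-congˡ (sym (product-1 {M} λ i → inverse (toℕ i))) ⟩
      hom (progression y q c) M * product {M} (λ i → (1# - q ^ suc (toℕ i)) * inv (toℕ i))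
        ≈⟨ *-congˡ (product-distrib-* {M} _ _) ⟩
      hom (progression y q c) M * (factors 1 M * product {M} (inv ∘ toℕ))
        ≈⟨ sym (*-assoc _ _ _) ⟩
      hom (progression y q c) M * factors 1 M * product {M} (inv ∘ toℕ)
        ≈⟨ *-congʳ (hom-factors c M) ⟩
      y ^ M * factors c M * product {M} (inv ∘ toℕ)
        ≈⟨ trans (*-assoc _ _ _) (*-congˡ (sym (product-distrib-* {M} _ _))) ⟩
      y ^ M * product {M} (λ i → (1# - q ^ (c ℕ.+ toℕ i)) * inv (toℕ i)) ∎

-- Sums over tuples with a given sum.

module Tuples {c ℓ} (R : CommutativeRing c ℓ) where

  open CommutativeRing R hiding (zero)
  open FiniteSums R
  open Cauchy R
  open RawSemiringDefinitions (Semiring.rawSemiring semiring) using (product)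
  open SetoidReasoning setoid
  module S = RawSemiringDefinitions (Semiring.rawSemiring (CommutativeRing.semiring sequenceRing))

  ∑-upTo-cong : ∀ n {f g : ℕ → Carrier} → (∀ b → b < n → f b ≈ g b) → ∑ (upTo n) f ≈ ∑ (upTo n) g
  ∑-upTo-cong zero    p = refl
  ∑-upTo-cong (suc n) {f} {g} p = begin
    ∑ (upTo (suc n)) f   ≈⟨ ∑-upTo-last n f ⟩
    ∑ (upTo n) f + f n   ≈⟨ +-cong (∑-upTo-cong n λ b b<n → p b (ℕ.m<n⇒m<1+n b<n)) (p n ℕ.≤-refl) ⟩
    ∑ (upTo n) g + g n   ≈⟨ sym (∑-upTo-last n g) ⟩
    ∑ (upTo (suc n)) g   ∎

  ∑-upTo-truncate : ∀ d n {f : ℕ → Carrier} → (∀ b → n ≤ b → f b ≈ 0#) →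
    ∑ (upTo (d ℕ.+ n)) f ≈ ∑ (upTo n) f
  ∑-upTo-truncate zero    n p = refl
  ∑-upTo-truncate (suc d) n {f} p = begin
    ∑ (upTo (suc d ℕ.+ n)) f               ≈⟨ ∑-upTo-last (d ℕ.+ n) f ⟩
    ∑ (upTo (d ℕ.+ n)) f + f (d ℕ.+ n)     ≈⟨ +-cong (∑-upTo-truncate d n p) (p _ (ℕ.m≤n+m n d)) ⟩
    ∑ (upTo n) f + 0#                      ≈⟨ +-identityʳ _ ⟩
    ∑ (upTo n) f                           ∎

  private
    +-≡ᵇ-∸ : ∀ {b N} x → b ≤ N → (b ℕ.+ x ≡ᵇ N) ≡ (x ≡ᵇ N ∸ b)
    +-≡ᵇ-∸ x z≤n       = ≡.refl
    +-≡ᵇ-∸ x (s≤s b≤N) = +-≡ᵇ-∸ x b≤N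

    +-≢ᵇ : ∀ {b N} x → N < b → (b ℕ.+ x ≡ᵇ N) ≡ false
    +-≢ᵇ {N = zero}  x (s≤s _)   = ≡.refl
    +-≢ᵇ {N = suc N} x (s≤s N<b) = +-≢ᵇ x N<b

    if-*ˡ : ∀ a (b : Bool) x → (if b then a * x else 0#) ≈ a * (if b then x else 0#)
    if-*ˡ a true  x = refl
    if-*ˡ a false x = sym (zeroʳ a)

    -- The slack `d` carries the induction: after a first entry b the remaining sum drops to N - b
    -- while the bound on the entries stays, so b moves into the slack.
    ∑-boundedTuples : ∀ s (g : Fin s → ℕ → Carrier) N d →
      ∑[ i ∈ below (replicate s (d ℕ.+ N)) ]
        (if Vec.sum i ≡ᵇ N then product (λ l → g l (lookup i l)) else 0#)
      ≈ S.product g N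
    ∑-boundedTuples zero    g zero    d = +-identityʳ _
    ∑-boundedTuples zero    g (suc N) d = +-identityʳ _
    ∑-boundedTuples (suc s) g N       d = begin
      ∑ (below (B ∷ replicate s B)) F
        ≈⟨ ∑-cartesianProductWith _∷_ (upTo (suc B)) (below (replicate s B)) F ⟩
      ∑[ b ∈ upTo (suc B) ] G b
        ≡⟨ ≡.cong (λ n → ∑ (upTo n) G) (≡.sym (ℕ.+-suc d N)) ⟩
      ∑[ b ∈ upTo (d ℕ.+ suc N) ] G b
        ≈⟨ ∑-upTo-truncate d (suc N) above ⟩
      ∑[ b ∈ upTo (suc N) ] G b
        ≈⟨ ∑-upTo-cong (suc N) (λ b b<1+N → within b (ℕ.≤-pred b<1+N)) ⟩
      ∑[ b ∈ upTo (suc N) ] (g zero b * S.product (g ∘ suc) (N ∸ b))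
        ≈⟨ sym (⊛-as-∑ (g zero) (S.product (g ∘ suc)) N) ⟩
      S.product g N ∎
      where
      B : ℕ
      B = d ℕ.+ N
      F : Vec ℕ (suc s) → Carrier
      F i = if Vec.sum i ≡ᵇ N then product (λ l → g l (lookup i l)) else 0#
      G : ℕ → Carrier
      G b = ∑[ i ∈ below (replicate s B) ] F (b ∷ i)
      F′ : ℕ → Vec ℕ s → Carrier
      F′ M i = if Vec.sum i ≡ᵇ M then product (λ l → g (suc l) (lookup i l)) else 0#
      above : ∀ b → suc N ≤ b → G b ≈ 0#
      above b N<b = trans
        (∑-cong (below (replicate s B)) λ i → reflexive (≡.cong
          (λ c → if c then product (λ l → g l (lookup (b ∷ i) l)) else 0#) (+-≢ᵇ (Vec.sum i) N<b)))
        (∑-zero (below (replicate s B)))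
      within : ∀ b → b ≤ N → G b ≈ g zero b * S.product (g ∘ suc) (N ∸ b)
      within b b≤N = begin
        G b
          ≈⟨ ∑-cong (below (replicate s B)) (λ i → trans
            (reflexive (≡.cong (λ c → if c then product (λ l → g l (lookup (b ∷ i) l)) else 0#)
              (+-≡ᵇ-∸ (Vec.sum i) b≤N)))
            (if-*ˡ (g zero b) (Vec.sum i ≡ᵇ N ∸ b) _)) ⟩
        ∑[ i ∈ below (replicate s B) ] (g zero b * F′ (N ∸ b) i)
          ≈⟨ sym (*-distribˡ-∑ (g zero b) (below (replicate s B)) (F′ (N ∸ b))) ⟩
        g zero b * ∑ (below (replicate s B)) (F′ (N ∸ b))
          ≡⟨ ≡.cong (λ n → g zero b * ∑ (below (replicate s n)) (F′ (N ∸ b)))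
            (≡.trans (≡.cong (d ℕ.+_) (≡.sym (ℕ.m+[n∸m]≡n b≤N))) (≡.sym (ℕ.+-assoc d b (N ∸ b)))) ⟩
        g zero b * ∑ (below (replicate s (d ℕ.+ b ℕ.+ (N ∸ b)))) (F′ (N ∸ b))
          ≈⟨ *-congˡ (∑-boundedTuples s (g ∘ suc) (N ∸ b) (d ℕ.+ b)) ⟩
        g zero b * S.product (g ∘ suc) (N ∸ b) ∎

  -- Expansion of a product of generating functions in one variable: the N-th coefficient picks one
  -- index per factor, with indices adding up to N.
  ∑-tuplesWithSum : ∀ s (g : Fin s → ℕ → Carrier) N →
    ∑[ i ∈ tuplesWithSum s N ] product (λ l → g l (lookup i l)) ≈ S.product g N
  ∑-tuplesWithSum s g N = trans
    (∑-filter (λ i → Vec.sum i ℕ.≟ N) (below (replicate s N)) _) (∑-boundedTuples s g N 0)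

-- Coloured letters and the content of words.

module Letters {n : ℕ} (m r : Vector ℕ n) where

  open ColouredPermutations m r using (Letter; _^ᶜ_; letter; letters)

  infix 4 _≟_

  _≟_ : DecidableEquality Letter
  (k ^ᶜ c) ≟ (l ^ᶜ d) with k Fin.≟ l
  ... | no  k≢l    = no λ { ≡.refl → k≢l ≡.refl }
  ... | yes ≡.refl = map′ (≡.cong (k ^ᶜ_)) (λ { ≡.refl → ≡.refl }) (c Fin.≟ d)

  ∈-letters : ∀ a → a ∈ letters
  ∈-letters (k ^ᶜ c) = ∈-concat⁺′ (∈-map⁺ (k ^ᶜ_) (∈-allFin c))
    (∈-map⁺ (λ k → map (k ^ᶜ_) (allFin (r k))) (∈-allFin k))

  letters-unique : Unique letters
  letters-unique = Unique.concat⁺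
    (All.map⁺ (All.tabulate λ {k} _ → Unique.map⁺ (λ { ≡.refl → ≡.refl }) (Unique.allFin⁺ (r k))))
    (AllPairs.map⁺ (AllPairs.map disjoint (Unique.allFin⁺ n)))
    where
    disjoint : ∀ {k l} → k ≢ l → ∀ {a} →
      (a ∈ map (k ^ᶜ_) (allFin (r k)) × a ∈ map (l ^ᶜ_) (allFin (r l))) → _
    disjoint k≢l (a∈k , a∈l) with ∈-map⁻ _ a∈k | ∈-map⁻ _ a∈l
    ... | _ , _ , ≡.refl | _ , _ , ≡.refl = k≢l ≡.refl

  content? : ∀ {s} (μ : Vector ℕ n) (π : Vec Letter s) →
    Dec (∀ k → count (λ a → letter a Fin.≟ k) π ≡ μ k)
  content? μ π = Fin.all? λ k → count (λ a → letter a Fin.≟ k) π ℕ.≟ μ k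

  infixl 6 _-[_]

  _-[_] : Vector ℕ n → Fin n → Vector ℕ n
  (μ -[ k ]) j = if does (k Fin.≟ j) then pred (μ j) else μ j

  content-∷-zero : ∀ {s} μ b (π : Vec Letter s) → μ (letter b) ≡ 0 → does (content? μ (b ∷ π)) ≡ false
  content-∷-zero μ b π μb≡0 = dec-false (content? μ (b ∷ π)) λ p →
    ℕ.1+n≢0 (≡.trans (≡.sym (≡.cong (λ d → (if d then suc else id) (count (λ a → letter a Fin.≟ letter b) π))
      (dec-true (letter b Fin.≟ letter b) ≡.refl))) (≡.trans (p (letter b)) μb≡0))

  content-∷-suc : ∀ {s} μ b (π : Vec Letter s) {M} → μ (letter b) ≡ suc M →
    does (content? μ (b ∷ π)) ≡ does (content? (μ -[ letter b ]) π)
  content-∷-suc μ b π {M} μb≡1+M = does-⇔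
    (mk⇔ (λ p k → to k (p k)) (λ p k → from k (p k))) (content? μ (b ∷ π)) (content? (μ -[ letter b ]) π)
    where
    to : ∀ k → count (λ a → letter a Fin.≟ k) (b ∷ π) ≡ μ k → count (λ a → letter a Fin.≟ k) π ≡ (μ -[ letter b ]) k
    to k p with letter b Fin.≟ k
    ... | yes _ = ≡.cong pred p
    ... | no  _ = p
    from : ∀ k → count (λ a → letter a Fin.≟ k) π ≡ (μ -[ letter b ]) k → count (λ a → letter a Fin.≟ k) (b ∷ π) ≡ μ k
    from k p with letter b Fin.≟ k
    ... | yes ≡.refl = ≡.trans (≡.cong suc (≡.trans p (≡.cong pred μb≡1+M))) (≡.sym μb≡1+M)
    ... | no  _      = p

total-cong : ∀ {n} {μ ν : Vector ℕ n} → (∀ k → μ k ≡ ν k) → total μ ≡ total ν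
total-cong {zero}  p = ≡.refl
total-cong {suc n} p = ≡.cong₂ ℕ._+_ (p zero) (total-cong (p ∘ suc))

total-pred : ∀ {n} (μ : Vector ℕ n) k {M} → μ k ≡ suc M →
  suc (total (λ j → if does (k Fin.≟ j) then pred (μ j) else μ j)) ≡ total μ
total-pred μ zero    p = ≡.cong (ℕ._+ total (μ ∘ suc)) (≡.trans (≡.cong (λ x → suc (pred x)) p) (≡.sym p))
total-pred μ (suc k) p = ≡.trans (≡.sym (ℕ.+-suc (μ zero) _)) (≡.cong (μ zero ℕ.+_) (total-pred (μ ∘ suc) k p))

total≡0 : ∀ {n} (μ : Vector ℕ n) → total μ ≡ 0 → ∀ k → μ k ≡ 0
total≡0 μ p zero    = ℕ.m+n≡0⇒m≡0 (μ zero) p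
total≡0 μ p (suc k) = total≡0 (μ ∘ suc) (ℕ.m+n≡0⇒n≡0 (μ zero) p) k

total≡suc : ∀ {n} (μ : Vector ℕ n) {s} → total μ ≡ suc s → ∃ λ k → ∃ λ M → μ k ≡ suc M
total≡suc {suc n} μ p with μ zero in eq
... | suc M = zero , M , eq
... | zero  with total≡suc (μ ∘ suc) p
...   | k , M , q = suc k , M , q

-- Sums with conditional terms.

module Conditional {c ℓ} (R : CommutativeRing c ℓ) where

  open CommutativeRing R
  open FiniteSums R

  if-+ : ∀ (b : Bool) x y → (if b then x + y else 0#) ≈ (if b then x else 0#) + (if b then y else 0#)
  if-+ true  x y = refl
  if-+ false x y = sym (+-identityˡ 0#)

  if-* : ∀ (b : Bool) a x → (if b then a * x else 0#) ≈ a * (if b then x else 0#)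
  if-* true  a x = refl
  if-* false a x = sym (zeroʳ a)

  if-elim : ∀ {p} {P : Set p} (d : Dec P) {x y z} → (P → x ≈ z) → (¬ P → y ≈ z) →
    (if does d then x else y) ≈ z
  if-elim (yes p) f g = f p
  if-elim (no ¬p) f g = g ¬p

  if-cong : ∀ {p} {P : Set p} (d : Dec P) {x x′ y y′} → (P → x ≈ x′) → (¬ P → y ≈ y′) →
    (if does d then x else y) ≈ (if does d then x′ else y′)
  if-cong (yes p) f g = f p
  if-cong (no ¬p) f g = g ¬p

  if-0 : ∀ (b : Bool) → (if b then 0# else 0#) ≈ 0#
  if-0 true  = refl
  if-0 false = refl

  if-comm : ∀ (b c : Bool) x →
    (if b then (if c then x else 0#) else 0#) ≈ (if c then (if b then x else 0#) else 0#)
  if-comm true  c     x = refl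
  if-comm false true  x = refl
  if-comm false false x = refl

  if-∑ : ∀ (b : Bool) {A : Set} (xs : List A) (f : A → Carrier) →
    ∑[ x ∈ xs ] (if b then f x else 0#) ≈ (if b then ∑ xs f else 0#)
  if-∑ true  xs f = refl
  if-∑ false xs f = ∑-zero xs

  module _ {A : Set} (_≟_ : DecidableEquality A) where

    ∑-absent : ∀ {xs b} (F : A → Carrier) → All (b ≢_) xs →
      ∑[ a ∈ xs ] (if does (a ≟ b) then F a else 0#) ≈ 0#
    ∑-absent F [] = refl
    ∑-absent {x ∷ _} {b} F (b≢x ∷ b∉xs) = trans
      (+-cong (reflexive (≡.cong (if_then F x else 0#) (dec-false (x ≟ b) (b≢x ∘ ≡.sym)))) (∑-absent F b∉xs))
      (+-identityˡ 0#)

    ∑-single : ∀ {xs b} (F : A → Carrier) → Unique xs → b ∈ xs →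
      ∑[ a ∈ xs ] (if does (a ≟ b) then F a else 0#) ≈ F b
    ∑-single {x ∷ _} {b} F (x∉xs ∷ _) (here ≡.refl) = trans
      (+-cong (reflexive (≡.cong (if_then F x else 0#) (dec-true (x ≟ x) ≡.refl))) (∑-absent F x∉xs))
      (+-identityʳ (F b))
    ∑-single {x ∷ _} {b} F (x∉xs ∷ u) (there b∈xs) = trans
      (+-cong (reflexive (≡.cong (if_then F x else 0#) (dec-false (x ≟ b) (All.lookup x∉xs b∈xs)))) (∑-single F u b∈xs))
      (+-identityˡ (F b))

-- From words placed into slots to a product over the letters.

module Spelling {c ℓ} (R : CommutativeRing c ℓ) {n : ℕ} (m r : Vector ℕ n) where

  open CommutativeRing R hiding (zero)
  open FiniteSums R
  open Conditional R
  open Cauchy R using (_⊛_; sequenceRing; constant; constant-⊛)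
  open Products R
  open Homogeneous R using (hom)
  open RawSemiringDefinitions (Semiring.rawSemiring semiring) using (product)
  open ColouredPermutations m r using (Letter; _^ᶜ_; letter; letters; wordsOver)
  open Letters m r
  open SetoidReasoning setoid
  module S = CommutativeRing sequenceRing
  open RawSemiringDefinitions (Semiring.rawSemiring S.semiring) using () renaming (product to S-product)

  -- Slots are weighted places for letters, in order; spell π S sums the weights
  -- of all ways of placing the letters of π into S, in weakly increasing
  -- order and each into a slot of the same letter.
  Slots : Set c
  Slots = List (Letter × Carrier)

  spell : ∀ {s} → Vec Letter s → Slots → Carrier
  spell []      S             = 1#
  spell (a ∷ π) []            = 0#
  spell (a ∷ π) ((b , ω) ∷ S) =
    spell (a ∷ π) S + (if does (a ≟ b) then ω * spell π ((b , ω) ∷ S) else 0#)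

  weights : Letter → Slots → List Carrier
  weights a S = map proj₂ (filter ((a ≟_) ∘ proj₁) S)

  -- The Cauchy product over the colours distributes M copies of the letter among its colours; the
  -- copies of one colour form a multiset of its slots, which `hom` enumerates.
  placements : Fin n → Slots → ℕ → Carrier
  placements k S = S-product λ c → hom (weights (k ^ᶜ c) S)

  placements-[] : ∀ k M → placements k [] M ≈ constant 1# M
  placements-[] k M = trans (Products.product-cong sequenceRing {r k} (λ _ → hom-[]) M) (ones (r k) M)
    where
    hom-[] : ∀ M → hom [] M ≈ constant 1# M
    hom-[] zero    = refl
    hom-[] (suc M) = refl
    ones : ∀ s → S-product {s} (λ _ → constant 1#) S.≈ constant 1#
    ones zero    = S.refl {constant 1#}
    ones (suc s) = S.trans {constant 1# ⊛ S-product {s} (λ _ → constant 1#)}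
      (S.*-identityˡ (S-product {s} (λ _ → constant 1#))) (ones s)

  placements-other : ∀ {k b} ω S M → letter b ≢ k → placements k ((b , ω) ∷ S) M ≈ placements k S M
  placements-other {k} {b} ω S M b≢k = Products.product-cong sequenceRing {r k} (λ c M → reflexive
    (≡.cong (λ Y → hom (map proj₂ Y) M) (filter-reject (((k ^ᶜ c) ≟_) ∘ proj₁) {b , ω} {S}
      (b≢k ∘ ≡.sym ∘ ≡.cong letter)))) M

  private
    monomial₁ : Carrier → ℕ → Carrier
    monomial₁ ω zero    = 0#
    monomial₁ ω (suc M) = constant ω M

    -- As a generating function in the number of copies, a new slot of weight ω divides by 1 - ωX.
    -- With the denominator cleared this reads P′ = P + ωX P′, where `monomial₁ ω` is ωX. Only the
    -- factor for the colour of `b` changes.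
    placements-∷ : ∀ b ω S → placements (letter b) ((b , ω) ∷ S) S.≈
      (placements (letter b) S S.+ (monomial₁ ω ⊛ placements (letter b) ((b , ω) ∷ S)))
    placements-∷ b@(k ^ᶜ c) ω S = Products.product-affine sequenceRing new old new (monomial₁ ω) c
      at-c (λ d d≢c M → reflexive (≡.cong (λ Y → hom Y M) (other d d≢c))) (λ d _ M → refl)
      where
      new old : Fin (r k) → ℕ → Carrier
      new d = hom (weights (k ^ᶜ d) ((b , ω) ∷ S))
      old d = hom (weights (k ^ᶜ d) S)
      other : ∀ d → d ≢ c → weights (k ^ᶜ d) ((b , ω) ∷ S) ≡ weights (k ^ᶜ d) S
      other d d≢c = ≡.cong (map proj₂) (filter-reject (((k ^ᶜ d) ≟_) ∘ proj₁) λ { ≡.refl → d≢c ≡.refl })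
      same : weights b ((b , ω) ∷ S) ≡ ω ∷ weights b S
      same = ≡.cong (map proj₂) (filter-accept ((b ≟_) ∘ proj₁) ≡.refl)
      hom-∷ : ∀ Y M → hom (ω ∷ Y) M ≈ hom Y M + (monomial₁ ω ⊛ hom (ω ∷ Y)) M
      hom-∷ Y zero    = sym (trans (+-cong (Homogeneous.hom-zero R Y) (zeroˡ _)) (+-identityʳ _))
      hom-∷ Y (suc M) = +-congˡ (sym (trans (+-congʳ (zeroˡ _)) (trans (+-identityˡ _) (constant-⊛ ω _ M))))
      at-c : ∀ M → new c M ≈ old c M + (monomial₁ ω ⊛ new c) M
      at-c M rewrite same = hom-∷ (weights b S) M

  placements-∷-zero : ∀ b ω S → placements (letter b) ((b , ω) ∷ S) 0 ≈ placements (letter b) S 0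
  placements-∷-zero b ω S =
    trans (placements-∷ b ω S 0) (trans (+-congˡ (zeroˡ _)) (+-identityʳ _))

  placements-∷-suc : ∀ b ω S M → placements (letter b) ((b , ω) ∷ S) (suc M) ≈
    placements (letter b) S (suc M) + ω * placements (letter b) ((b , ω) ∷ S) M
  placements-∷-suc b ω S M = trans (placements-∷ b ω S (suc M))
    (+-congˡ (trans (+-congʳ (zeroˡ _)) (trans (+-identityˡ _) (constant-⊛ ω _ M))))

  placements-zero : ∀ k S → placements k S 0 ≈ 1#
  placements-zero k []            = placements-[] k 0
  placements-zero k ((b , ω) ∷ S) with letter b Fin.≟ k
  ... | yes ≡.refl = trans (placements-∷-zero b ω S) (placements-zero k S)
  ... | no  b≢k    = trans (placements-other ω S 0 b≢k) (placements-zero k S)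

  spellings : ∀ s → Vector ℕ n → Slots → Carrier
  spellings s μ S = ∑[ π ∈ wordsOver letters s ] (if does (content? μ π) then spell π S else 0#)

  private
    -- Placements increase weakly, so a used first slot holds the first letter of the word, which
    -- must then be `b`; the rest of the word may use the same slot again.
    spellings-∷ : ∀ s μ b ω S → spellings (suc s) μ ((b , ω) ∷ S) ≈ spellings (suc s) μ S +
      ω * (∑[ π ∈ wordsOver letters s ] (if does (content? μ (b ∷ π)) then spell π ((b , ω) ∷ S) else 0#))
    spellings-∷ s μ b ω S = begin
      spellings (suc s) μ ((b , ω) ∷ S)
        ≈⟨ ∑-cartesianProductWith _∷_ letters W _ ⟩
      ∑[ a ∈ letters ] ∑[ π ∈ W ] (if does (content? μ (a ∷ π)) then
        spell (a ∷ π) S + (if does (a ≟ b) then ω * spell π S′ else 0#) else 0#)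
        ≈⟨ ∑-cong letters (λ a → trans
          (∑-cong W (λ π → trans (if-+ (does (content? μ (a ∷ π))) _ _)
            (+-congˡ (if-comm (does (content? μ (a ∷ π))) (does (a ≟ b)) _))))
          (trans (∑-distrib-+ W _ _) (+-congˡ (if-∑ (does (a ≟ b)) W _)))) ⟩
      ∑[ a ∈ letters ] ((∑[ π ∈ W ] (if does (content? μ (a ∷ π)) then spell (a ∷ π) S else 0#)) +
        (if does (a ≟ b) then tailSum a else 0#))
        ≈⟨ ∑-distrib-+ letters _ _ ⟩
      (∑[ a ∈ letters ] ∑[ π ∈ W ] (if does (content? μ (a ∷ π)) then spell (a ∷ π) S else 0#)) +
        (∑[ a ∈ letters ] (if does (a ≟ b) then tailSum a else 0#))
        ≈⟨ +-cong (sym (∑-cartesianProductWith _∷_ letters W _))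
          (∑-single _≟_ tailSum letters-unique (∈-letters b)) ⟩
      spellings (suc s) μ S + tailSum b
        ≈⟨ +-congˡ (trans (∑-cong W (λ π → if-* (does (content? μ (b ∷ π))) ω _)) (sym (*-distribˡ-∑ ω W _))) ⟩
      _ ∎
      where
      S′ : Slots
      S′ = (b , ω) ∷ S
      W : List (Vec Letter s)
      W = wordsOver letters s
      tailSum : Letter → Carrier
      tailSum a = ∑[ π ∈ W ] (if does (content? μ (a ∷ π)) then ω * spell π S′ else 0#)

  private
    placements-step : ∀ s μ b ω S → total μ ≡ suc s →
      spellings (suc s) μ S ≈ product (λ k → placements k S (μ k)) →
      (∀ ν → total ν ≡ s → spellings s ν ((b , ω) ∷ S) ≈ product (λ k → placements k ((b , ω) ∷ S) (ν k))) →
      spellings (suc s) μ ((b , ω) ∷ S) ≈ product (λ k → placements k ((b , ω) ∷ S) (μ k))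
    placements-step s μ b ω S p shorter fewer with μ (letter b) in μb
    ... | zero = begin
      spellings (suc s) μ S′
        ≈⟨ spellings-∷ s μ b ω S ⟩
      spellings (suc s) μ S + ω * (∑[ π ∈ W ] (if does (content? μ (b ∷ π)) then spell π S′ else 0#))
        ≈⟨ +-cong (shorter) (trans (*-congˡ (trans
          (∑-cong W λ π → reflexive (≡.cong (if_then spell π S′ else 0#) (content-∷-zero μ b π μb)))
          (∑-zero W))) (zeroʳ ω)) ⟩
      product (λ k → placements k S (μ k)) + 0#
        ≈⟨ +-identityʳ _ ⟩
      product (λ k → placements k S (μ k))
        ≈⟨ product-cong unchanged ⟩
      product (λ k → placements k S′ (μ k)) ∎
      where
      S′ : Slots
      S′ = (b , ω) ∷ S
      W : List (Vec Letter s)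
      W = wordsOver letters s
      unchanged : ∀ k → placements k S (μ k) ≈ placements k S′ (μ k)
      unchanged k with letter b Fin.≟ k
      ... | yes ≡.refl = trans (reflexive (≡.cong (placements k S) μb))
        (trans (sym (placements-∷-zero b ω S)) (reflexive (≡.cong (placements k S′) (≡.sym μb))))
      ... | no  b≢k    = sym (placements-other ω S (μ k) b≢k)
    ... | suc M = begin
      spellings (suc s) μ S′
        ≈⟨ spellings-∷ s μ b ω S ⟩
      spellings (suc s) μ S + ω * (∑[ π ∈ W ] (if does (content? μ (b ∷ π)) then spell π S′ else 0#))
        ≈⟨ +-cong (shorter) (*-congˡ (trans
          (∑-cong W λ π → reflexive (≡.cong (if_then spell π S′ else 0#) (content-∷-suc μ b π μb)))
          (fewer ν (ℕ.suc-injective (≡.trans (total-pred μ (letter b) μb) p))))) ⟩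
      product (λ k → placements k S (μ k)) + ω * product (λ k → placements k S′ (ν k))
        ≈⟨ sym (product-affine _ _ _ ω (letter b) at-b
          (λ j j≢b → placements-other ω S (μ j) (j≢b ∘ ≡.sym))
          (λ j j≢b → reflexive (≡.cong (λ d → placements j S′ (if d then pred (μ j) else μ j))
            (≡.sym (dec-false (letter b Fin.≟ j) (j≢b ∘ ≡.sym)))))) ⟩
      product (λ k → placements k S′ (μ k)) ∎
      where
      S′ : Slots
      S′ = (b , ω) ∷ S
      W : List (Vec Letter s)
      W = wordsOver letters s
      ν : Vector ℕ n
      ν = μ -[ letter b ]
      νb : ν (letter b) ≡ M
      νb = ≡.trans (≡.cong (if_then pred (μ (letter b)) else μ (letter b)) (dec-true (letter b Fin.≟ letter b) ≡.refl))
        (≡.cong pred μb)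
      at-b : placements (letter b) S′ (μ (letter b)) ≈
        placements (letter b) S (μ (letter b)) + ω * placements (letter b) S′ (ν (letter b))
      at-b = begin
        placements (letter b) S′ (μ (letter b))  ≡⟨ ≡.cong (placements (letter b) S′) μb ⟩
        placements (letter b) S′ (suc M)         ≈⟨ placements-∷-suc b ω S M ⟩
        placements (letter b) S (suc M) + ω * placements (letter b) S′ M
          ≡⟨ ≡.cong₂ (λ i j → placements (letter b) S i + ω * placements (letter b) S′ j) (≡.sym μb) (≡.sym νb) ⟩
        placements (letter b) S (μ (letter b)) + ω * placements (letter b) S′ (ν (letter b)) ∎

  spellings≈placements : ∀ s μ S → total μ ≡ s → spellings s μ S ≈ product (λ k → placements k S (μ k))
  spellings≈placements zero μ S p = begin
    (if does (content? μ []) then 1# else 0#) + 0#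
      ≈⟨ +-identityʳ _ ⟩
    (if does (content? μ []) then 1# else 0#)
      ≡⟨ ≡.cong (if_then 1# else 0#) (dec-true (content? μ []) (λ k → ≡.sym (total≡0 μ p k))) ⟩
    1#
      ≈⟨ sym (product-1 λ k → trans (reflexive (≡.cong (placements k S) (total≡0 μ p k))) (placements-zero k S)) ⟩
    product (λ k → placements k S (μ k)) ∎
  spellings≈placements (suc s) μ [] p = begin
    spellings (suc s) μ []
      ≈⟨ ∑-cartesianProductWith _∷_ letters (wordsOver letters s) _ ⟩
    ∑[ a ∈ letters ] ∑[ π ∈ wordsOver letters s ] (if does (content? μ (a ∷ π)) then 0# else 0#)
      ≈⟨ ∑-cong letters (λ a → trans (∑-cong (wordsOver letters s) (λ π → if-0 (does (content? μ (a ∷ π)))))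
        (∑-zero (wordsOver letters s))) ⟩
    ∑[ a ∈ letters ] 0#
      ≈⟨ ∑-zero letters ⟩
    0#
      -- Some letter has positive multiplicity and no slot to go to, so its factor is 0.
      ≈⟨ sym (product-0 k (trans (placements-[] k (μ k)) (reflexive (≡.cong (constant 1#) μk≡suc)))) ⟩
    product (λ k → placements k [] (μ k)) ∎
    where
    k : Fin n
    k = proj₁ (total≡suc μ p)
    μk≡suc : μ k ≡ suc (proj₁ (proj₂ (total≡suc μ p)))
    μk≡suc = proj₂ (proj₂ (total≡suc μ p))
  spellings≈placements (suc s) μ ((b , ω) ∷ S) p = placements-step s μ b ω S p
    (spellings≈placements (suc s) μ S p) (λ ν q → spellings≈placements s ν ((b , ω) ∷ S) q)

-- The colour order on letters.

module ColourOrder {n : ℕ} (m r : Vector ℕ n) where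

  open ColouredPermutations m r using (Letter; _^ᶜ_; letter; colour; letters; numbered; _<ᶜ_)
  open Letters m r

  -- `swap` puts the colour first, which makes the lexicographic order unfold to `_<ᶜ_`.
  letterOrder : StrictTotalOrder _ _ _
  letterOrder = On.strictTotalOrder
    (×-strictTotalOrder ℕ.<-strictTotalOrder ℕ.<-strictTotalOrder) (swap ∘ numbered)

  infix 4 _≺_

  _≺_ : Letter → Letter → Set
  a ≺ b = numbered a <ᶜ numbered b

  ≺-trans : ∀ {a b c} → a ≺ b → b ≺ c → a ≺ c
  ≺-trans {a} {b} {c} = StrictTotalOrder.trans letterOrder {a} {b} {c}

  ≺⇒≢ : ∀ {a b} → a ≺ b → a ≢ b
  ≺⇒≢ {a} a≺a ≡.refl = StrictTotalOrder.irrefl letterOrder {a} {a} (≡.refl , ≡.refl) a≺a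

  private
    order : DecTotalOrder _ _ _
    order = StrictTotalOrderProperties.decTotalOrder letterOrder

    numbered-injective : ∀ {a b} → numbered a ≡ numbered b → a ≡ b
    numbered-injective {k ^ᶜ c} {l ^ᶜ d} eq with Fin.toℕ-injective (ℕ.suc-injective (≡.cong proj₁ eq))
    ... | ≡.refl = ≡.cong (k ^ᶜ_) (Fin.toℕ-injective (ℕ.suc-injective (≡.cong proj₂ eq)))

  open Sort order

  -- `letters` runs letter by letter, whereas the slots inside a level must follow the colour order,
  -- so that a placement has to leave the level at a descent.
  sorted : List Letter
  sorted = sort letters

  ∈-sorted : ∀ a → a ∈ sorted
  ∈-sorted a = ∈-resp-↭ (↭-sym (sort-↭ letters)) (∈-letters a)

  sorted-unique : Unique sorted
  sorted-unique = PermutationSetoid.Unique-resp-↭ (≡.setoid Letter) (↭⇒↭ₛ (↭-sym (sort-↭ letters))) letters-unique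

  sorted-≺ : AllPairs _≺_ sorted
  sorted-≺ = AllPairs.zipWith strict
    (Sorted⇒AllPairs (DecTotalOrder.totalOrder order) (sort-↗ letters) , sorted-unique)
    where
    strict : ∀ {a b} → DecTotalOrder._≤_ order a b × a ≢ b → a ≺ b
    strict (inj₁ a≺b       , _)   = a≺b
    strict (inj₂ (c≡d , k≡l) , a≢b) = contradiction (numbered-injective (≡.cong₂ _,_ k≡l c≡d)) a≢b

-- The number of levels v ≤ t in which a colour occurs among the slots: level t
-- contains the first colour only.
visits : ∀ {s} → Fin s → ℕ → ℕ
visits zero    t = suc t
visits (suc _) t = t

-- The coefficients of the fraction attached to a word.

module Expansion {c ℓ} (R : CommutativeRing c ℓ) {n : ℕ} (m r : Vector ℕ n)
  (x y : ColouredPermutations.Letter m r → CommutativeRing.Carrier R) (w : CommutativeRing.Carrier R) where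

  open CommutativeRing R hiding (zero)
  open FiniteSums R
  open Homogeneous R using (progression)
  open CommutativeSemiringExp commutativeSemiring using (_^_; ^-congˡ)
  open Geometric R
  open RawSemiringDefinitions (Semiring.rawSemiring semiring) using (product)
  open ColouredPermutations m r using (Letter; letter; colour; numbered; _<ᶜ_; _<ᶜ?_)
  open Letters m r
  open ColourOrder m r
  open Spelling R m r
  open Conditional R
  open SetoidReasoning setoid

  weight : ∀ {s} → Vec Letter s → Carrier
  weight π = foldr _*_ 1# (map x (toList π))

  level : List Letter → Slots
  level = map λ a → a , y a

  shift : Slots → Slots
  shift = map λ (a , ω) → a , x a * ω

  visible : ℕ → List Letter
  visible zero    = filter (λ a → toℕ (colour a) ℕ.≟ 0) sorted
  visible (suc t) = sorted

  -- The slots are the pairs (v , a) below (t , (n+1)¹) in the lexicographic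
  -- order, with weight x_a^v y_a; after level 0, those for t are those for
  -- t - 1 shifted by one.
  slots previous : ℕ → Slots
  slots t = level (visible t) ++ previous t
  previous zero    = []
  previous (suc t) = shift (slots t)

  extend : ∀ {s} → Vec Letter s → Vec (ℕ × ℕ) (suc s)
  extend π = Vec.map numbered π ∷ʳ (suc n , 1)

  descends? : ∀ {s} a (π : Vec Letter s) → Dec (lookup (extend π) zero <ᶜ numbered a)
  descends? a π = lookup (extend π) zero <ᶜ? numbered a

  -- A letter only enters slots of its own kind, so every placement of the word gains the same
  -- factor: one `x` per letter.
  spell-shift : ∀ {s} (π : Vec Letter s) S → spell π (shift S) ≈ weight π * spell π S
  spell-shift []      S             = sym (*-identityˡ _)
  spell-shift (a ∷ π) []            = sym (zeroʳ _)
  spell-shift (a ∷ π) ((b , ω) ∷ S) = trans (+-cong (spell-shift (a ∷ π) S) at-b) (sym (distribˡ _ _ _))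
    where
    open CommutativeSemigroupProperties *-commutativeSemigroup using (interchange)
    at-b : (if does (a ≟ b) then x b * ω * spell π (shift ((b , ω) ∷ S)) else 0#) ≈
      weight (a ∷ π) * (if does (a ≟ b) then ω * spell π ((b , ω) ∷ S) else 0#)
    at-b with a ≟ b
    ... | yes ≡.refl = trans (*-congˡ (spell-shift π ((b , ω) ∷ S))) (interchange _ _ _ _)
    ... | no  _      = sym (zeroʳ _)

  spell-∉ : ∀ {s} a (π : Vec Letter s) {bs} S → All (a ≢_) bs → spell (a ∷ π) (level bs ++ S) ≈ spell (a ∷ π) S
  spell-∉ a π {[]}     S []           = refl
  spell-∉ a π {b ∷ bs} S (a≢b ∷ a∉bs) = trans
    (+-cong (spell-∉ a π S a∉bs) (reflexive (≡.cong (if_then _ else 0#) (dec-false (a ≟ b) a≢b))))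
    (+-identityʳ _)

  -- The strictly increasing level has one slot for `a`, which is skipped or taken. If it is taken,
  -- a next letter c ≺ a has its slot, if any, before that of `a` and must leave the level. Any
  -- other next letter differs from all those before `a`, so their slots can be put back without
  -- effect.
  spell-∈ : ∀ {s} a (π : Vec Letter s) {bs} S → AllPairs _≺_ bs → a ∈ bs →
    spell (a ∷ π) (level bs ++ S) ≈
      spell (a ∷ π) S + y a * (if does (descends? a π) then spell π S else spell π (level bs ++ S))
  spell-∈ a π {_ ∷ bs} S (a≺bs ∷ _) (here ≡.refl) = +-cong
    (spell-∉ a π S (All.map ≺⇒≢ a≺bs))
    (if-elim (a ≟ a) (λ _ → *-congˡ (atHead π)) (λ a≢a → contradiction ≡.refl a≢a))
    where
    atHead : ∀ {s} (π : Vec Letter s) → spell π (level (a ∷ bs) ++ S) ≈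
      (if does (descends? a π) then spell π S else spell π (level (a ∷ bs) ++ S))
    atHead []      = sym (if-elim (descends? a []) (λ _ → refl) (λ _ → refl))
    atHead (c ∷ π) = sym (if-elim (descends? a (c ∷ π))
      (λ c≺a → sym (spell-∉ c π S (≺⇒≢ c≺a ∷ All.map (λ {d} a≺d → ≺⇒≢ (≺-trans {c} {a} {d} c≺a a≺d)) a≺bs)))
      (λ _ → refl))
  spell-∈ a π {b ∷ bs} S (b≺bs ∷ bs≺) (there a∈bs) = begin
    spell (a ∷ π) (level bs ++ S) + (if does (a ≟ b) then _ else 0#)
      ≈⟨ +-congˡ (reflexive (≡.cong (if_then _ else 0#) (dec-false (a ≟ b) (≺⇒≢ b≺a ∘ ≡.sym)))) ⟩
    spell (a ∷ π) (level bs ++ S) + 0#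
      ≈⟨ trans (+-identityʳ _) (spell-∈ a π S bs≺ a∈bs) ⟩
    spell (a ∷ π) S + y a * (if does (descends? a π) then spell π S else spell π (level bs ++ S))
      ≈⟨ +-congˡ (*-congˡ (skip π)) ⟩
    spell (a ∷ π) S + y a * (if does (descends? a π) then spell π S else spell π (level (b ∷ bs) ++ S)) ∎
    where
    b≺a : b ≺ a
    b≺a = All.lookup b≺bs a∈bs
    skip : ∀ {s} (π : Vec Letter s) →
      (if does (descends? a π) then spell π S else spell π (level bs ++ S)) ≈
      (if does (descends? a π) then spell π S else spell π (level (b ∷ bs) ++ S))
    skip []      = refl
    skip (c ∷ π) = if-cong (descends? a (c ∷ π)) (λ _ → refl)
      (λ c⊀a → sym (spell-∉ c π {b ∷ []} (level bs ++ S) ((λ { ≡.refl → c⊀a b≺a }) ∷ [])))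

  -- `predecessor` lists the coefficients after multiplication by `w`, hence the 0 at t = 0.
  coefficient predecessor : ∀ {s} → Vec Letter s → ℕ → Carrier
  coefficient π t           = spell π (slots t)
  predecessor π zero    = 0#
  predecessor π (suc t) = coefficient π t

  private
    FirstColour : Letter → Set
    FirstColour a = toℕ (colour a) ≡ 0

    visible-≺ : ∀ t → AllPairs _≺_ (visible t)
    visible-≺ zero    = AllPairs.filter⁺ (λ a → toℕ (colour a) ℕ.≟ 0) sorted-≺
    visible-≺ (suc t) = sorted-≺

    visible-∌ : ∀ a → ¬ FirstColour a → All (a ≢_) (visible zero)
    visible-∌ a c≢0 = All.map (λ { d≡0 ≡.refl → c≢0 d≡0 }) (All.all-filter (λ a → toℕ (colour a) ℕ.≟ 0) sorted)

    spell-previous : ∀ {s} a (π : Vec Letter s) t →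
      spell (a ∷ π) (previous t) ≈ weight (a ∷ π) * predecessor (a ∷ π) t
    spell-previous a π zero    = sym (zeroʳ _)
    spell-previous a π (suc t) = spell-shift (a ∷ π) (slots t)

  -- The sequences with f_1 ≥ 1 give the first term, those with f_1 = 0 the second.
  coefficient-∷ : ∀ {s} a (π : Vec Letter s) t →
    coefficient (a ∷ π) t ≈ weight (a ∷ π) * predecessor (a ∷ π) t +
      y a * (if does (descends? a π) then weight π * predecessor π t else coefficient π t)
  coefficient-∷ a π (suc t) = trans
    (spell-∈ a π (previous (suc t)) (visible-≺ (suc t)) (∈-sorted a))
    (+-cong (spell-previous a π (suc t)) (*-congˡ (branch (does (descends? a π)))))
    where
    branch : ∀ d → (if d then spell π (previous (suc t)) else coefficient π (suc t)) ≈
      (if d then weight π * coefficient π t else coefficient π (suc t))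
    branch true  = spell-shift π (slots t)
    branch false = refl
  coefficient-∷ a π zero with toℕ (colour a) ℕ.≟ 0
  ... | yes c≡0 = trans
    (spell-∈ a π [] (visible-≺ zero) (∈-filter⁺ (λ a → toℕ (colour a) ℕ.≟ 0) (∈-sorted a) c≡0))
    (+-cong (spell-previous a π zero) (*-congˡ (branch π)))
    where
    branch : ∀ {s} (π : Vec Letter s) → (if does (descends? a π) then spell π [] else coefficient π zero) ≈
      (if does (descends? a π) then weight π * 0# else coefficient π zero)
    branch (b ∷ π) = if-cong (descends? a (b ∷ π)) (λ _ → sym (zeroʳ _)) (λ _ → refl)
    -- For the empty rest the two values under a descent are 1 and 0, so a descent must be excluded:
    -- a letter of the first colour lies below the appended (n+1)¹.
    branch []      = if-cong (descends? a [])
      (λ { (inj₁ 1<1+c)     → contradiction (ℕ.≤-pred 1<1+c) (ℕ.≤⇒≯ (ℕ.≤-reflexive c≡0))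
         ; (inj₂ (_ , n<k)) → contradiction (Fin.toℕ<n (letter a)) (ℕ.<-asym (ℕ.≤-pred n<k)) })
      (λ _ → refl)
  ... | no  c≢0 = begin
    coefficient (a ∷ π) zero
      ≈⟨ spell-∉ a π [] (visible-∌ a c≢0) ⟩
    0#
      ≈⟨ sym (trans (+-cong (zeroʳ _) (trans (*-congˡ (branch π)) (zeroʳ _))) (+-identityʳ _)) ⟩
    weight (a ∷ π) * 0# + y a * (if does (descends? a π) then weight π * 0# else coefficient π zero) ∎
    where
    branch : ∀ {s} (π : Vec Letter s) → (if does (descends? a π) then weight π * 0# else coefficient π zero) ≈ 0#
    -- Here the descent is forced, since a later colour lies above the appended (n+1)¹; otherwise
    -- the empty rest would contribute 1.
    branch []      = if-elim (descends? a []) (λ _ → zeroʳ _)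
      (λ ¬d → contradiction (inj₁ (s≤s (ℕ.n≢0⇒n>0 c≢0))) ¬d)
    branch (b ∷ π) = if-elim (descends? a (b ∷ π)) (λ _ → zeroʳ _)
      (λ b⊀a → spell-∉ b π [] (visible-∌ b λ d≡0 →
        b⊀a (inj₁ (s≤s (≡.subst (_< toℕ (colour a)) (≡.sym d≡0) (ℕ.n≢0⇒n>0 c≢0))))))

  -- Clearing denominators modulo a power of `w`.

  tail : ∀ {s} → Vec Letter s → Fin (suc s) → Carrier
  tail π i = foldr _*_ 1# (map x (drop (toℕ i) (toList π))) * w

  denominator : ∀ {s} → Vec Letter s → Carrier
  denominator {s} π = product {suc s} λ i → 1# - tail π i

  descentProduct : ∀ {s} → Vec Letter s → Carrier
  descentProduct {s} π = product {s} λ j →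
    if does (lookup (extend π) (suc j) <ᶜ? lookup (extend π) (inject₁ j)) then tail π (suc j) else 1#

  colourProduct : ∀ {s} → Vec Letter s → Carrier
  colourProduct π = foldr _*_ 1# (map y (toList π))

  generating : ∀ {s} → Vec Letter s → ℕ → Carrier
  generating π T = ∑[ t ∈ upTo T ] (w ^ t * coefficient π t)

  module _ (T : ℕ) where

    open Congruence R (w ^ T)
    open RingProperties ring

    generating-predecessor : ∀ {s} (π : Vec Letter s) →
      ∑[ t ∈ upTo T ] (w ^ t * predecessor π t) ∼ w * generating π T
    -- The left sum stops one term short: the missing term is `w ^ T * predecessor π T`, hence the
    -- cofactor.
    generating-predecessor π = - predecessor π T , (begin
      A                                            ≈⟨ sym (//-rightDividesʳ (w ^ T * predecessor π T) A) ⟩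
      A + w ^ T * predecessor π T - w ^ T * predecessor π T
        ≈⟨ +-cong shifted (-‿distribʳ-* _ _) ⟩
      w * generating π T + w ^ T * - predecessor π T ∎)
      where
      A : Carrier
      A = ∑[ t ∈ upTo T ] (w ^ t * predecessor π t)
      shifted : A + w ^ T * predecessor π T ≈ w * generating π T
      shifted = begin
        A + w ^ T * predecessor π T
          ≈⟨ sym (∑-upTo-last T _) ⟩
        ∑[ t ∈ upTo (suc T) ] (w ^ t * predecessor π t)
          ≈⟨ ∑-upTo-suc T _ ⟩
        1# * 0# + (∑[ t ∈ upTo T ] (w * w ^ t * coefficient π t))
          ≈⟨ trans (+-congʳ (zeroʳ _)) (+-identityˡ _) ⟩
        ∑[ t ∈ upTo T ] (w * w ^ t * coefficient π t)
          ≈⟨ ∑-cong (upTo T) (λ t → *-assoc _ _ _) ⟩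
        ∑[ t ∈ upTo T ] (w * (w ^ t * coefficient π t))
          ≈⟨ sym (*-distribˡ-∑ w (upTo T) _) ⟩
        w * generating π T ∎

    descentFactor : ∀ {s} → Letter → Vec Letter s → Carrier
    descentFactor a π = if does (descends? a π) then weight π * w else 1#

    -- Summed against the powers of `w`, `coefficient-∷` says that G is X w G plus a multiple of the
    -- series of `π`, each predecessor costing a factor `w`. Moving X w G to the left exposes the
    -- first factor of the denominator; at a descent, `weight π * w` is the tail product after `a`.
    generating-∷ : ∀ {s} a (π : Vec Letter s) →
      (1# - weight (a ∷ π) * w) * generating (a ∷ π) T ∼ y a * (descentFactor a π * generating π T)
    generating-∷ a π = ∼-trans
      (∼-reflexive (trans ([y-z]x≈yx-zx _ _ _) (+-congʳ (trans (*-identityˡ _) split))))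
      (∼-trans (∼-+ (∼-+ (∼-*ˡ X (generating-predecessor (a ∷ π))) (∼-*ˡ (y a) (branch (descends? a π))))
        (∼-reflexive (refl { - (X * w * generating (a ∷ π) T)})))
      (∼-reflexive (begin
        X * (w * G) + y a * (descentFactor a π * generating π T) - X * w * G
          ≈⟨ +-cong (+-comm _ _) (-‿cong (*-assoc _ _ _)) ⟩
        y a * (descentFactor a π * generating π T) + X * (w * G) - X * (w * G)
          ≈⟨ //-rightDividesʳ _ _ ⟩
        y a * (descentFactor a π * generating π T) ∎)))
      where
      open CommutativeSemigroupProperties *-commutativeSemigroup using (x∙yz≈y∙xz)
      X G : Carrier
      X = weight (a ∷ π)
      G = generating (a ∷ π) T
      option : Bool → ℕ → Carrier
      option d t = if d then weight π * predecessor π t else coefficient π t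
      split : G ≈ X * (∑[ t ∈ upTo T ] (w ^ t * predecessor (a ∷ π) t)) +
        y a * (∑[ t ∈ upTo T ] (w ^ t * option (does (descends? a π)) t))
      split = begin
        G
          ≈⟨ ∑-cong (upTo T) (λ t → trans (*-congˡ (coefficient-∷ a π t)) (trans (distribˡ _ _ _)
            (+-cong (x∙yz≈y∙xz _ _ _) (x∙yz≈y∙xz _ _ _)))) ⟩
        ∑[ t ∈ upTo T ] (X * (w ^ t * predecessor (a ∷ π) t) + y a * (w ^ t * option (does (descends? a π)) t))
          ≈⟨ ∑-distrib-+ (upTo T) _ _ ⟩
        (∑[ t ∈ upTo T ] (X * (w ^ t * predecessor (a ∷ π) t))) +
          (∑[ t ∈ upTo T ] (y a * (w ^ t * option (does (descends? a π)) t)))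
          ≈⟨ sym (+-cong (*-distribˡ-∑ X (upTo T) _) (*-distribˡ-∑ (y a) (upTo T) _)) ⟩
        _ ∎
      branch : ∀ {P : Set} (d : Dec P) → (∑[ t ∈ upTo T ] (w ^ t * option (does d) t)) ∼
        (if does d then weight π * w else 1#) * generating π T
      branch (no  _) = ∼-reflexive (sym (*-identityˡ _))
      branch (yes _) = ∼-trans
        (∼-reflexive (trans (∑-cong (upTo T) (λ t → x∙yz≈y∙xz _ _ _)) (sym (*-distribˡ-∑ (weight π) (upTo T) _))))
        (∼-trans (∼-*ˡ (weight π) (generating-predecessor π)) (∼-reflexive (sym (*-assoc _ _ _))))

    -- Tail products see only suffixes, so deleting the first letter deletes the first factor of
    -- `denominator` and of `descentProduct`, and `generating-∷` accounts for both. The denominator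
    -- stays on the left, where it makes sense in any commutative ring.
    denominator-generating : ∀ {s} (π : Vec Letter s) →
      denominator π * generating π T ∼ colourProduct π * descentProduct π
    -- Only the factor 1 - w of the appended letter remains. Its truncated geometric series gives 1
    -- - w^T, hence the cofactor -1.
    denominator-generating [] = - 1# , (begin
      (1# - 1# * w) * 1# * generating [] T
        ≈⟨ *-cong (trans (*-identityʳ _) (+-congˡ (-‿cong (*-identityˡ w)))) (∑-cong (upTo T) λ t → *-identityʳ (w ^ t)) ⟩
      (1# - w) * ∑ (upTo T) (w ^_)
        ≈⟨ *-congˡ (∑-cong (upTo T) λ t → ^-congˡ t (sym (1-[1-x]≈x w))) ⟩
      (1# - w) * ∑ (upTo T) ((1# - (1# - w)) ^_)
        ≈⟨ *-geometric (1# - w) T ⟩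
      1# - (1# - (1# - w)) ^ T
        ≈⟨ +-cong (sym (*-identityˡ 1#)) (-‿cong (trans (^-congˡ T (1-[1-x]≈x w)) (sym (*-identityʳ _)))) ⟩
      1# * 1# - w ^ T * 1#
        ≈⟨ +-congˡ (-‿distribʳ-* _ _) ⟩
      1# * 1# + w ^ T * - 1# ∎)
    denominator-generating (a ∷ π) = ∼-trans
      (∼-reflexive (trans (*-congʳ (*-comm _ _)) (*-assoc _ _ _)))
      (∼-trans (∼-*ˡ (denominator π) (generating-∷ a π))
      (∼-trans (∼-reflexive (trans (x∙yz≈y∙xz _ _ _) (*-congˡ (x∙yz≈y∙xz _ _ _))))
      (∼-trans (∼-*ˡ (y a) (∼-*ˡ (descentFactor a π) (denominator-generating π)))
      (∼-reflexive (trans (*-congˡ (x∙yz≈y∙xz _ _ _)) (sym (*-assoc _ _ _)))))))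
      where open CommutativeSemigroupProperties *-commutativeSemigroup using (x∙yz≈y∙xz)

  private
    visits-suc : ∀ {s} (c : Fin s) t → visits c (suc t) ≡ suc (visits c t)
    visits-suc zero    t = ≡.refl
    visits-suc (suc _) t = ≡.refl

    visits-first : ∀ {s} (c : Fin s) → toℕ c ≡ 0 → visits c 0 ≡ 1
    visits-first zero _ = ≡.refl

    visits-later : ∀ {s} (c : Fin s) → toℕ c ≢ 0 → visits c 0 ≡ 0
    visits-later zero    c≢0 = contradiction ≡.refl c≢0
    visits-later (suc _) _   = ≡.refl

    weights-++ : ∀ a S S′ → weights a (S ++ S′) ≡ weights a S ++ weights a S′
    weights-++ a S S′ = ≡.trans (≡.cong (map proj₂) (filter-++ ((a ≟_) ∘ proj₁) S S′))
      (map-++ proj₂ (filter ((a ≟_) ∘ proj₁) S) _)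

    weights-accept : ∀ a ω S → weights a ((a , ω) ∷ S) ≡ ω ∷ weights a S
    weights-accept a ω S = ≡.cong (map proj₂) (filter-accept ((a ≟_) ∘ proj₁) ≡.refl)

    weights-reject : ∀ {a b} ω S → a ≢ b → weights a ((b , ω) ∷ S) ≡ weights a S
    weights-reject {a} ω S a≢b = ≡.cong (map proj₂) (filter-reject ((a ≟_) ∘ proj₁) a≢b)

    weights-shift : ∀ a S → weights a (shift S) ≡ map (x a *_) (weights a S)
    weights-shift a []            = ≡.refl
    weights-shift a ((b , ω) ∷ S) with a ≟ b
    ... | yes ≡.refl = ≡.cong (x a * ω ∷_) (weights-shift a S)
    ... | no  _      = weights-shift a S

    weights-∉ : ∀ a {bs} → All (a ≢_) bs → weights a (level bs) ≡ []
    weights-∉ a []                    = ≡.refl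
    weights-∉ a {b ∷ bs} (a≢b ∷ a∉bs) = ≡.trans (weights-reject (y b) (level bs) a≢b) (weights-∉ a a∉bs)

    weights-∈ : ∀ a {bs} → AllPairs _≺_ bs → a ∈ bs → weights a (level bs) ≡ y a ∷ []
    weights-∈ a {_ ∷ bs} (a≺bs ∷ _) (here ≡.refl) =
      ≡.trans (weights-accept a (y a) (level bs)) (≡.cong (y a ∷_) (weights-∉ a (All.map ≺⇒≢ a≺bs)))
    weights-∈ a {b ∷ bs} (b≺bs ∷ bs≺) (there a∈bs) = ≡.trans
      (weights-reject (y b) (level bs) (≺⇒≢ (All.lookup b≺bs a∈bs) ∘ ≡.sym)) (weights-∈ a bs≺ a∈bs)

  -- A new level prepends `y a` and multiplies the older weights by `x a`, which is the recursion of
  -- `progression`.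
  weights-slots : ∀ a t → weights a (slots t) ≡ progression (y a) (x a) (visits (colour a) t)
  weights-slots a (suc t) = ≡.trans (weights-++ a (level sorted) (shift (slots t)))
    (≡.trans (≡.cong₂ _++_ (weights-∈ a sorted-≺ (∈-sorted a))
      (≡.trans (weights-shift a (slots t)) (≡.cong (map (x a *_)) (weights-slots a t))))
    (≡.cong (progression (y a) (x a)) (≡.sym (visits-suc (colour a) t))))
  weights-slots a zero = ≡.trans (≡.cong (weights a) (++-identityʳ (level (visible 0)))) base
    where
    base : weights a (level (visible 0)) ≡ progression (y a) (x a) (visits (colour a) 0)
    base with toℕ (colour a) ℕ.≟ 0
    ... | yes c≡0 = ≡.trans (weights-∈ a (visible-≺ 0) (∈-filter⁺ (λ a → toℕ (colour a) ℕ.≟ 0) (∈-sorted a) c≡0))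
      (≡.cong (progression (y a) (x a)) (≡.sym (visits-first (colour a) c≡0)))
    ... | no  c≢0 = ≡.trans (weights-∉ a (visible-∌ a c≢0))
      (≡.cong (progression (y a) (x a)) (≡.sym (visits-later (colour a) c≢0)))

-- The identity modulo a power of `w` in any commutative ring.

module TruncatedIdentity {c ℓ} (R : CommutativeRing c ℓ) {n : ℕ} (m r : Vector ℕ n)
  (x : ColouredPermutations.Letter m r → CommutativeRing.Carrier R)
  (v : Fin (maximum r) → CommutativeRing.Carrier R) (w : CommutativeRing.Carrier R) where

  open CommutativeRing R hiding (zero)
  open FiniteSums R
  open Products R
  open Homogeneous R using (hom; progression; hom-progression)
  open Tuples R using (∑-tuplesWithSum)
  open CommutativeSemiringExp commutativeSemiring using (_^_)
  open RawSemiringDefinitions (Semiring.rawSemiring semiring) using (product)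
  open ColouredPermutations m r
    using (Letter; _^ᶜ_; letter; colour; letters; wordsOver; |m|; r-max; Word; 𝔖; hasContent?)
  open Spelling R m r
  open SetoidReasoning setoid

  y : Letter → Carrier
  y a = v (inject≤ (colour a) (≤-maximum r (letter a)))

  open Expansion R m r x y w

  ∏-colourCount : ∀ {s} (π : Vec Letter s) →
    product {r-max} (λ p → v p ^ count (λ a → toℕ (colour a) ℕ.≟ toℕ p) π) ≈ colourProduct π
  ∏-colourCount []      = product-1 {r-max} λ _ → refl
  ∏-colourCount (a ∷ π) = trans
    (product-scale _ _ (y a) p at-p elsewhere)
    (*-congˡ (∏-colourCount π))
    where
    p : Fin r-max
    p = inject≤ (colour a) (≤-maximum r (letter a))
    number : Fin r-max → ℕ
    number q = count (λ a → toℕ (colour a) ℕ.≟ toℕ q) π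
    at-p : v p ^ count (λ a → toℕ (colour a) ℕ.≟ toℕ p) (a ∷ π) ≈ v p * v p ^ number p
    at-p = reflexive (≡.cong (λ d → v p ^ (if d then suc else id) (number p))
      (dec-true (toℕ (colour a) ℕ.≟ toℕ p) (≡.sym (Fin.toℕ-inject≤ (colour a) _))))
    elsewhere : ∀ q → q ≢ p → v q ^ count (λ a → toℕ (colour a) ℕ.≟ toℕ q) (a ∷ π) ≈ v q ^ number q
    elsewhere q q≢p = reflexive (≡.cong (λ d → v q ^ (if d then suc else id) (number q))
      (dec-false (toℕ (colour a) ℕ.≟ toℕ q) λ c≡q →
        q≢p (Fin.toℕ-injective (≡.trans (≡.sym c≡q) (≡.sym (Fin.toℕ-inject≤ (colour a) _))))))

  -- Inverses and q-binomials enter as given elements with their defining equations, because R is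
  -- arbitrary; the power series supply them at the end.
  module _ (gauss : ∀ k → Fin (r k) → ℕ → ℕ → Carrier)
    (inv : Letter → ℕ → Carrier) (inv-inverse : ∀ a i → (1# - x a ^ suc i) * inv a i ≈ 1#)
    (gauss-product : ∀ k l t M → gauss k l t M ≈
      product {M} λ i → (1# - x (k ^ᶜ l) ^ (visits l t ℕ.+ toℕ i)) * inv (k ^ᶜ l) (toℕ i))
    where

    placements-gauss : ∀ k t M → placements k (slots t) M ≈
      ∑[ i ∈ tuplesWithSum (r k) M ] product λ l → gauss k l t (lookup i l) * y (k ^ᶜ l) ^ lookup i l
    placements-gauss k t M = begin
      placements k (slots t) M
        ≈⟨ sym (∑-tuplesWithSum (r k) (λ l → hom (weights (k ^ᶜ l) (slots t))) M) ⟩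
      ∑[ i ∈ tuplesWithSum (r k) M ] product (λ l → hom (weights (k ^ᶜ l) (slots t)) (lookup i l))
        ≈⟨ ∑-cong (tuplesWithSum (r k) M) (λ i → product-cong λ l → begin
          hom (weights (k ^ᶜ l) (slots t)) (lookup i l)
            ≡⟨ ≡.cong (λ Y → hom Y (lookup i l)) (weights-slots (k ^ᶜ l) t) ⟩
          hom (progression (y (k ^ᶜ l)) (x (k ^ᶜ l)) (visits l t)) (lookup i l)
            ≈⟨ hom-progression (y (k ^ᶜ l)) (x (k ^ᶜ l)) (inv (k ^ᶜ l)) (inv-inverse (k ^ᶜ l)) (visits l t) (lookup i l) ⟩
          _ ≈⟨ *-comm _ _ ⟩
          _ ≈⟨ *-congʳ (sym (gauss-product k l t (lookup i l))) ⟩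
          gauss k l t (lookup i l) * y (k ^ᶜ l) ^ lookup i l ∎) ⟩
      ∑[ i ∈ tuplesWithSum (r k) M ] product (λ l → gauss k l t (lookup i l) * y (k ^ᶜ l) ^ lookup i l) ∎

    ∑-coefficient : ∀ t → ∑[ π ∈ 𝔖 ] coefficient π t ≈ product λ k →
      ∑[ i ∈ tuplesWithSum (r k) (m k) ] product λ l → gauss k l t (lookup i l) * y (k ^ᶜ l) ^ lookup i l
    ∑-coefficient t = begin
      ∑[ π ∈ 𝔖 ] coefficient π t
        ≈⟨ ∑-filter hasContent? (wordsOver letters |m|) _ ⟩
      spellings |m| m (slots t)
        ≈⟨ spellings≈placements |m| m (slots t) ≡.refl ⟩
      product (λ k → placements k (slots t) (m k))
        ≈⟨ product-cong (λ k → placements-gauss k t (m k)) ⟩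
      _ ∎

    ∑-generating : ∀ T → ∑[ π ∈ 𝔖 ] generating π T ≈ ∑[ t ∈ upTo T ] (w ^ t * product λ k →
      ∑[ i ∈ tuplesWithSum (r k) (m k) ] product λ l → gauss k l t (lookup i l) * y (k ^ᶜ l) ^ lookup i l)
    ∑-generating T = begin
      ∑[ π ∈ 𝔖 ] ∑[ t ∈ upTo T ] (w ^ t * coefficient π t)
        ≈⟨ ∑-comm 𝔖 (upTo T) _ ⟩
      ∑[ t ∈ upTo T ] ∑[ π ∈ 𝔖 ] (w ^ t * coefficient π t)
        ≈⟨ ∑-cong (upTo T) (λ t → trans (sym (*-distribˡ-∑ (w ^ t) 𝔖 _)) (*-congˡ (∑-coefficient t))) ⟩
      _ ∎

    module _ (T : ℕ) (denominator⁻¹ : Word → Carrier)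
      (denominator-inverse : ∀ π → denominator π * denominator⁻¹ π ≈ 1#) where

      open Congruence R (w ^ T)

      summand : Word → Carrier
      summand π = product {r-max} (λ p → v p ^ count (λ a → toℕ (colour a) ℕ.≟ toℕ p) π) *
        descentProduct π * denominator⁻¹ π

      generating∼summand : ∀ π → generating π T ∼ summand π
      generating∼summand π = ∼-trans
        (∼-reflexive (begin
          generating π T
            ≈⟨ sym (*-identityˡ _) ⟩
          1# * generating π T
            ≈⟨ *-congʳ (trans (sym (denominator-inverse π)) (*-comm _ _)) ⟩
          denominator⁻¹ π * denominator π * generating π T
            ≈⟨ *-assoc _ _ _ ⟩
          denominator⁻¹ π * (denominator π * generating π T) ∎))
        (∼-trans (∼-*ˡ (denominator⁻¹ π) (denominator-generating T π))
        (∼-reflexive (trans (*-comm _ _) (*-congʳ (*-congʳ (sym (∏-colourCount π)))))))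

      truncated-identity :
        ∑[ t ∈ upTo T ] (w ^ t * product λ k → ∑[ i ∈ tuplesWithSum (r k) (m k) ]
          product λ l → gauss k l t (lookup i l) * y (k ^ᶜ l) ^ lookup i l)
        ∼ ∑[ π ∈ 𝔖 ] summand π
      truncated-identity = ∼-trans (∼-reflexive (sym (∑-generating T))) (∼-∑ 𝔖 generating∼summand)

-- The exponents in the Gaussian coefficients, and the theorem.

-- The fraction is -(l+1)/(l+2), strictly between -1 and 0.
floor-[1-l]/l : ∀ l → floor ((+ 1 ℤ.- + suc (suc l)) / suc (suc l)) ≡ -1ℤ
floor-[1-l]/l l
  rewrite ℕ.m<n⇒m%n≡m (ℕ.n<1+n (suc l))
        | ℕ.m<n⇒m/n≡0 (ℕ.n<1+n (suc l)) = ≡.refl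

-- M cancels and the exponent becomes t + floor + i + 1. The floor is 0 for the first colour and -1
-- for the others, which is exactly how `visits` differs from t + 1.
gaussian-exponent : ∀ {s} (l : Fin s) t M i →
  ∣ + t ℤ.+ floor ((+ 1 ℤ.- + suc (toℕ l)) / suc (toℕ l)) ℤ.+ + M ℤ.- + M ℤ.+ + suc i ∣ ≡ visits l t ℕ.+ i
gaussian-exponent l t M i = ≡.trans
  (≡.cong (λ e → ∣ e ℤ.+ + suc i ∣) (GroupProperties.//-rightDividesʳ (AbelianGroup.group ℤ.+-0-abelianGroup) (+ M)
    (+ t ℤ.+ floor ((+ 1 ℤ.- + suc (toℕ l)) / suc (toℕ l))))) (go l)
  where
  go : ∀ {s} (l : Fin s) →
    ∣ + t ℤ.+ floor ((+ 1 ℤ.- + suc (toℕ l)) / suc (toℕ l)) ℤ.+ + suc i ∣ ≡ visits l t ℕ.+ i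
  go zero    = ≡.trans (≡.cong (ℕ._+ suc i) (ℕ.+-identityʳ t)) (ℕ.+-suc t i)
  -- As t - 1 is negative for t = 0, the -1 is first cancelled against `suc i`.
  go (suc l) = ≡.trans (≡.cong (λ f → ∣ + t ℤ.+ f ℤ.+ + suc i ∣) (floor-[1-l]/l (toℕ l)))
    (≡.cong ∣_∣ (ℤ.+-assoc (+ t) -1ℤ (+ suc i)))

theorem6 : ∀ (n : ℕ) → 1 ≤ n → (m r : Vector ℕ n) →
    (∀ k → 1 ≤ m k) → (∀ k → 1 ≤ r k) →
    let open ColouredPermutations m r in
    (λ t → w ^ t *
    (∏[ k < n ] ∑[ i ∈ tuplesWithSum (r k) (m k) ] ∏[ l < r k ]
    gaussian
    (+ t ℤ.+ floor ((+ 1 ℤ.- + suc (toℕ l)) / suc (toℕ l)) ℤ.+ + lookup i l)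
    (lookup i l)
    (z k l ^ r k)
    * y (inject≤ l (≤-maximum r k)) ^ lookup i l))
    SumsTo
    (∑[ π ∈ 𝔖 ] numerator π * denominator π ⁻¹)
-- The degree of α plus one suffices as T₀: the error is a multiple of w^T and has order at least T,
-- beyond α.
theorem6 n _ m r _ 1≤r α = suc (Vec.sum α) , λ T α<T →
  coefficient-∼ {g = ∑[ π ∈ 𝔖 ] numerator π * denominator π ⁻¹} vanish-w T α α<T
    (truncated-identity gauss inv inv-inverse gauss-product T (λ π → denominator π ⁻¹) denominator-inverse)
  where
  open ColouredPermutations m r

  S : CommutativeRing _ _
  S = SeriesRing.seriesRing (total r ℕ.+ (r-max ℕ.+ 1))

  open Vanishing (total r ℕ.+ (r-max ℕ.+ 1))

  x : Letter → Series
  x a = z (letter a) (colour a) ^ r (letter a)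

  open TruncatedIdentity S m r x y w using (truncated-identity)

  vanish-x : ∀ a → Vanish 1 (x a)
  -- A positive exponent is what gives `x a` constant term 0, and so makes 1 - x^(i+1) invertible.
  vanish-x a with r (letter a) | 1≤r (letter a)
  ... | suc s | _ = vanish-^suc {z (letter a) (colour a)} (vanish-X (flatten r (letter a) (colour a) ↑ˡ _)) s

  vanish-w : Vanish 1 w
  vanish-w = vanish-X (total r ↑ʳ (r-max ↑ʳ zero))

  inv : Letter → ℕ → Series
  inv a i = (1# - x a ^ suc i) ⁻¹

  inv-inverse : ∀ a i → (1# - x a ^ suc i) * inv a i ≈ 1#
  inv-inverse a i = *-⁻¹ (1# - x a ^ suc i) (oneMod-1-x {x a ^ suc i} (vanish-^suc {x a} (vanish-x a) i))

  -- Every tail product, the last one included, contains `w`, so each factor of the denominator has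
  -- constant coefficient 1.
  denominator-inverse : ∀ π → denominator π * denominator π ⁻¹ ≈ 1#
  denominator-inverse π = *-⁻¹ (denominator π) (oneMod-product (λ i → 1# - tailProduct π i) λ i →
    oneMod-1-x {tailProduct π i} (vanish-*ˡ {g = w} (tailWeight i) vanish-w))
    where
    tailWeight : Fin (suc |m|) → Series
    tailWeight i = foldr _*_ 1# (map x (drop (toℕ i) (Vec.toList π)))

  topIndex : ∀ {s} → Fin s → ℕ → ℕ → ℤ
  topIndex l t M = + t ℤ.+ floor ((+ 1 ℤ.- + suc (toℕ l)) / suc (toℕ l)) ℤ.+ + M

  gauss : ∀ k → Fin (r k) → ℕ → ℕ → Series
  gauss k l t M = gaussian (topIndex l t M) M (z k l ^ r k)

  gauss-product : ∀ k l t M → gauss k l t M ≈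
    ∏[ i < M ] (1# - x (k ^ᶜ l) ^ (visits l t ℕ.+ toℕ i)) * inv (k ^ᶜ l) (toℕ i)
  gauss-product k l t M = Products.product-cong S {M}
    {λ i → factor ∣ topIndex l t M ℤ.- + M ℤ.+ + suc (toℕ i) ∣ (toℕ i)}
    {λ i → factor (visits l t ℕ.+ toℕ i) (toℕ i)}
    (λ i → CommutativeRing.reflexive S (≡.cong (λ e → factor e (toℕ i)) (gaussian-exponent l t M (toℕ i))))
    where
    factor : ℕ → ℕ → Series
    factor e i = (1# - x (k ^ᶜ l) ^ e) * inv (k ^ᶜ l) i
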